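{- Let $J^c_n=T^c_n+T^c_n$ be the disjoint union of two copies of $T^c_n$. For each $\epsilon>0$, for $n$ and $c$ sufficiently large, we have $$\frac{|L(J^c_n)|}{|V(J^c_n)|}\leq\epsilon\quad\text{and}\quad\frac{s^L_2(J^c_n)}{|V(J^c_n)|}\geq 1-\epsilon.$$
   Context: **Game.** A position is a finite directed graph $G=(L\cup R,A)$ whose vertex set $V(G)=L\cup R$ is partitioned into $L=L(G)$ and $R=R(G)$. For $S\subseteq V(G)$, $G\setminus S$ is the subgraph induced on $V(G)\setminus S$. $\mathrm{Succ}(G,x)$ (resp. $\mathrm{Pred}(G,x)$) is the set of vertices reachable from $x$ (resp. that can reach $x$) by a directed path, including $x$. Left and Right alternate; Left chooses $x\in L$ and removes $\mathrm{Succ}(G,x)$, Right chooses $y\in R$ and removes $\mathrm{Pred}(G,y)$; a player's score is the number of vertices he removed. **Relevant graphs.** $\mathrm{Forc}(G)=\{x\in L:\mathrm{Succ}(G,x)\subseteq L\}\cup\{y\in R:\mathrm{Pred}(G,y)\subseteq R\}$; $G$ is relevant if $\mathrm{Forc}(G)=\emptyset$, and $\mathcal{S}$ is the class of relevant graphs. On relevant graphs, forced vertices created by a move are immediately given to the player who moved: for $x\in L$, $\mathrm{Rmv}(G,x)=\mathrm{Succ}(G,x)\cup\mathrm{Forc}(G\setminus\mathrm{Succ}(G,x))$; for $y\in R$, $\mathrm{Rmv}(G,y)=\mathrm{Pred}(G,y)\cup\mathrm{Forc}(G\setminus\mathrm{Pred}(G,y))$; and $G_u=G\setminus\mathrm{Rmv}(G,u)$,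 again in $\mathcal{S}$. **Scores.** $s^L_1(G)$ (resp. $s^L_2(G)$) is Left's optimal score when Left (resp. Right) starts. Both are $0$ on the empty graph and, for nonempty $G\in\mathcal{S}$, $s^L_1(G)=\max_{x\in L}\{|\mathrm{Rmv}(G,x)|+s^L_2(G_x)\}$, $s^L_2(G)=\min_{y\in R}s^L_1(G_y)$. **Trees.** For integers $n\ge 0$, $c\ge 1$, $T^c_n$ is the rooted tree of depth $n+1$ with arcs oriented from parent to child (away from the root, which is at level $0$), in which every vertex of level $k$, $0\le k\le n-1$, has exactly $3$ children and every vertex of level $n$ has exactly $c$ children. $R$ is the set of leaves (level $n+1$) and $L$ is the set of all other vertices (levels $0,\dots,n$). These graphs are relevant. -}

module Defs where

open import Data.Bool using (if_then_else_)
open import Data.List using (List; []; _∷_; _++_; [_]; length; map; filter; concatMap; cartesianProductWith; upTo)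
open import Data.List.Extrema.Nat using (max; min)
open import Data.List.Membership.Propositional using (_∈_; _∉_; find; lose)
open import Data.List.Membership.Propositional.Properties
  using (∈-filter⁺; ∈-filter⁻; ∈-++⁺ˡ; ∈-map⁻; ∈-cartesianProductWith⁻)
import Data.List.Membership.DecPropositional as DecMembership
open import Data.List.Properties using (map-cong-local; filter-notAll; ∷-injective; ≡-dec)
open import Data.List.Relation.Binary.Disjoint.Propositional using (Disjoint)
open import Data.List.Relation.Unary.All as All using (All; all?; tabulate)
import Data.List.Relation.Unary.All.Properties as All
open import Data.List.Relation.Unary.AllPairs as AllPairs using (AllPairs)
import Data.List.Relation.Unary.AllPairs.Properties as AllPairs
open import Data.List.Relation.Unary.Any using (here; any?)
open import Data.List.Relation.Unary.Unique.Propositional using (Unique; []; _∷_)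
import Data.List.Relation.Unary.Unique.Propositional.Properties as Unique
open import Data.Nat using (ℕ; zero; suc; _+_; _≤_; _<_; _<ᵇ_; _≡ᵇ_; z≤n; s≤s)
import Data.Nat.Properties as ℕ
open import Data.Product using (∃; _×_; _,_; proj₁; proj₂; swap)
open import Data.Sum using (_⊎_; inj₁; inj₂; [_,_]′)
open import Data.Sum.Properties using (inj₁-injective; inj₂-injective)
import Data.Sum.Properties as Sum
open import Data.Sum.Relation.Binary.Pointwise using (Pointwise; ⊎-decidable)
open import Function using (_∘_)
open import Relation.Binary using (Rel; Decidable; DecidableEquality)
open import Relation.Binary.Construct.Closure.ReflexiveTransitive using (Star; ε; _◅_)
open import Relation.Binary.PropositionalEquality using (_≡_; _≢_; refl; sym; trans; cong)
open import Relation.Nullary using (Dec; yes; no; ¬_; ¬?; contradiction)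
open import Relation.Nullary.Decidable using (map′; _×-dec_)

data Player : Set where
  Left Right : Player

_≟ᴾ_ : DecidableEquality Player
Left  ≟ᴾ Left  = yes refl
Left  ≟ᴾ Right = no λ ()
Right ≟ᴾ Left  = no λ ()
Right ≟ᴾ Right = yes refl

-- The vertex set of the graph is the finite list `vertices`.  The type
-- `Vertex` is only an ambient universe of names, possibly infinite; arcs and
-- owners of names outside `vertices` play no role.  This way an induced
-- subgraph keeps the names of its vertices.
record Position : Set₁ where
  infix 4 _≟_ _⟶_ _⟶?_
  field
    Vertex   : Set
    _≟_      : DecidableEquality Vertex
    vertices : List Vertex
    unique   : Unique vertices
    _⟶_      : Vertex → Vertex → Set
    _⟶?_     : Decidable _⟶_
    owner    : Vertex → Player

  open DecMembership _≟_ public using (_∈?_)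

  owned : Player → List Vertex
  owned p = filter (λ x → owner x ≟ᴾ p) vertices

  Arc : Rel Vertex _
  Arc x y = x ∈ vertices × y ∈ vertices × x ⟶ y

  Arc? : Decidable Arc
  Arc? x y = (x ∈? vertices) ×-dec (y ∈? vertices) ×-dec (x ⟶? y)

  Reach : Rel Vertex _
  Reach = Star Arc

open Position using (Vertex; vertices; owner; owned; Arc; Arc?; Reach)

∣_∣ : Position → ℕ
∣ G ∣ = length (vertices G)

L R : (G : Position) → List (Vertex G)
L G = owned G Left
R G = owned G Right

infixl 6 _∖_
_∖_ : (G : Position) → List (Vertex G) → Position
G ∖ S = record
  { Vertex   = Vertex G
  ; _≟_      = G ._≟_
  ; vertices = filter (λ x → ¬? (_∈?_ G x S)) (vertices G)
  ; unique   = Unique.filter⁺ _ (unique G)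
  ; _⟶_      = G ._⟶_
  ; _⟶?_     = G ._⟶?_
  ; owner    = owner G
  } where open Position

∖-shrinks : ∀ G S {x} → x ∈ vertices G → x ∈ S → ∣ G ∖ S ∣ < ∣ G ∣
∖-shrinks G S x∈G x∈S = filter-notAll _ (vertices G) (lose x∈G (λ x∉S → x∉S x∈S))

-- Reachability is decidable: x reaches y ≠ x iff some out-neighbour of x
-- reaches y after x has been deleted.

private
  Arc-∖ : ∀ G S {x y} → Arc (G ∖ S) x y → Arc G x y
  Arc-∖ G S (x∈ , y∈ , a) = proj₁ (∈-filter⁻ _ x∈) , proj₁ (∈-filter⁻ _ y∈) , a

  Reach-∖ : ∀ G S {x y} → Reach (G ∖ S) x y → Reach G x y
  Reach-∖ G S ε       = ε
  Reach-∖ G S (a ◅ r) = Arc-∖ G S a ◅ Reach-∖ G S r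

  deleted-stuck : ∀ G {x y} → Reach (G ∖ [ x ]) x y → x ≡ y
  deleted-stuck G ε                  = refl
  deleted-stuck G ((x∈ , _) ◅ _) =
    contradiction (here refl) (proj₂ (∈-filter⁻ (λ z → ¬? (Position._∈?_ G z _)) {xs = vertices G} x∈))

  FirstStep : ∀ G → Rel (Vertex G) _
  FirstStep G x y = ∃ λ z → Arc G x z × Reach (G ∖ [ x ]) z y

  last-visit : ∀ G {x y w} → x ≢ y → Reach G w y → Reach (G ∖ [ x ]) w y ⊎ FirstStep G x y
  last-visit G x≢y ε = inj₁ ε
  last-visit G {x} {w = w} x≢y (_◅_ {j = v} a@(w∈ , v∈ , w⟶v) r) with last-visit G x≢y r
  ... | inj₂ s = inj₂ s
  ... | inj₁ r′ with Position._≟_ G w x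
  ...   | yes refl = inj₂ (v , a , r′)
  ...   | no w≢x with Position._≟_ G v x
  ...     | yes refl = contradiction (deleted-stuck G r′) x≢y
  ...     | no v≢x = inj₁ ((∈-filter⁺ _ w∈ (λ { (here w≡x) → w≢x w≡x }) ,
                            ∈-filter⁺ _ v∈ (λ { (here v≡x) → v≢x v≡x }) , w⟶v) ◅ r′)

  reach-within? : ∀ k G → ∣ G ∣ ≤ k → Decidable (Reach G)
  firstStep-within? : ∀ k G → ∣ G ∣ ≤ k → Decidable (FirstStep G)

  reach-within? k G ∣G∣≤k x y with Position._≟_ G x y
  ... | yes refl = yes ε
  ... | no x≢y = map′
    (λ (z , a , r) → a ◅ Reach-∖ G [ x ] r)
    (λ r → [ (λ r′ → contradiction (deleted-stuck G r′) x≢y) , (λ s → s) ]′ (last-visit G x≢y r))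
    (firstStep-within? k G ∣G∣≤k x y)

  firstStep-within? k G ∣G∣≤k x y with Position._∈?_ G x (vertices G)
  ... | no x∉G = no λ (_ , (x∈G , _) , _) → x∉G x∈G
  firstStep-within? zero    G ∣G∣≤k x y | yes x∈G = contradiction (ℕ.<-≤-trans (∖-shrinks G [ x ] x∈G (here refl)) ∣G∣≤k) λ ()
  firstStep-within? (suc k) G ∣G∣≤k x y | yes x∈G = map′
    (λ p → let (z , _ , q) = find p in z , q)
    (λ (z , a , r) → lose (proj₁ (proj₂ a)) (a , r))
    (any? (λ z → Arc? G x z ×-dec reach-within? k (G ∖ [ x ]) smaller z y) (vertices G))
    where
    smaller : ∣ G ∖ [ x ] ∣ ≤ k
    smaller = ℕ.≤-pred (ℕ.<-≤-trans (∖-shrinks G [ x ] x∈G (here refl)) ∣G∣≤k)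

reach? : ∀ G → Decidable (Reach G)
reach? G = reach-within? ∣ G ∣ G ℕ.≤-refl

Succ Pred : (G : Position) → Vertex G → List (Vertex G)
Succ G x = filter (λ y → reach? G x y) (vertices G)
Pred G x = filter (λ y → reach? G y x) (vertices G)

Taken : (G : Position) → Vertex G → List (Vertex G)
Taken G u with owner G u
... | Left  = Succ G u
... | Right = Pred G u

-- A vertex is forced when the move at it would take only vertices of its owner.
Forc : (G : Position) → List (Vertex G)
Forc G = filter (λ u → all? (λ v → owner G v ≟ᴾ owner G u) (Taken G u)) (vertices G)

-- The two lists are disjoint, so `length` counts the removed vertices.
Rmv : (G : Position) → Vertex G → List (Vertex G)
Rmv G u = Taken G u ++ Forc (G ∖ Taken G u)

infixl 7 _after_
_after_ : (G : Position) → Vertex G → Position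
G after u = G ∖ Rmv G u

-- The scores are meant for relevant graphs, those with Forc G ≡ [].  Such a
-- graph, if nonempty, has vertices of both owners, so there the
-- values of `maximum` and `minimum` at [] are used for the empty graph only.
maximum minimum : List ℕ → ℕ
maximum = max 0
minimum []       = 0
minimum (x ∷ xs) = min x xs

-- Scores with a bound on the number of moves; each move removes a vertex, so
-- the number of vertices is a sufficient bound (see s₁-step and s₂-step).
s₁-within s₂-within : ℕ → Position → ℕ
s₁-within zero    G = 0
s₁-within (suc k) G = maximum (map (λ x → length (Rmv G x) + s₂-within k (G after x)) (L G))
s₂-within zero    G = 0
s₂-within (suc k) G = minimum (map (λ y → s₁-within k (G after y)) (R G))

s₁ s₂ : Position → ℕ
s₁ G = s₁-within ∣ G ∣ G
s₂ G = s₂-within ∣ G ∣ G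

private
  ∈-Taken : ∀ G {u} → u ∈ vertices G → u ∈ Taken G u
  ∈-Taken G {u} u∈G with owner G u
  ... | Left  = ∈-filter⁺ (λ y → reach? G u y) u∈G ε
  ... | Right = ∈-filter⁺ (λ y → reach? G y u) u∈G ε

after-shrinks : ∀ G p {u} → u ∈ owned G p → ∣ G after u ∣ < ∣ G ∣
after-shrinks G p {u} u∈ = ∖-shrinks G (Rmv G u) u∈G (∈-++⁺ˡ (∈-Taken G u∈G))
  where
  u∈G : u ∈ vertices G
  u∈G = proj₁ (∈-filter⁻ (λ x → owner G x ≟ᴾ p) u∈)

private
  no-moves : ∀ G p → ∣ G ∣ ≤ 0 → owned G p ≡ []
  no-moves G p ∣G∣≤0 with vertices G
  ... | [] = refl

  after-bound : ∀ {k} G p {u} → ∣ G ∣ ≤ suc k → u ∈ owned G p → ∣ G after u ∣ ≤ k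
  after-bound G p b u∈ = ℕ.≤-pred (ℕ.<-≤-trans (after-shrinks G p u∈) b)

  s₁-stable : ∀ k l G → ∣ G ∣ ≤ k → ∣ G ∣ ≤ l → s₁-within k G ≡ s₁-within l G
  s₂-stable : ∀ k l G → ∣ G ∣ ≤ k → ∣ G ∣ ≤ l → s₂-within k G ≡ s₂-within l G

  s₁-stable zero    zero    G _ _ = refl
  s₁-stable zero    (suc l) G a _ rewrite no-moves G Left a = refl
  s₁-stable (suc k) zero    G _ b rewrite no-moves G Left b = refl
  s₁-stable (suc k) (suc l) G a b = cong maximum (map-cong-local (tabulate λ {x} x∈ →
    cong (length (Rmv G x) +_)
      (s₂-stable k l (G after x) (after-bound G Left a x∈) (after-bound G Left b x∈))))

  s₂-stable zero    zero    G _ _ = refl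
  s₂-stable zero    (suc l) G a _ rewrite no-moves G Right a = refl
  s₂-stable (suc k) zero    G _ b rewrite no-moves G Right b = refl
  s₂-stable (suc k) (suc l) G a b = cong minimum (map-cong-local (tabulate λ {y} y∈ →
    s₁-stable k l (G after y) (after-bound G Right a y∈) (after-bound G Right b y∈)))

s₁-step : ∀ G → s₁ G ≡ maximum (map (λ x → length (Rmv G x) + s₂ (G after x)) (L G))
s₁-step G = trans
  (s₁-stable ∣ G ∣ (suc ∣ G ∣) G ℕ.≤-refl (ℕ.n≤1+n _))
  (cong maximum (map-cong-local (tabulate λ {x} x∈ → cong (length (Rmv G x) +_)
    (s₂-stable ∣ G ∣ ∣ G after x ∣ (G after x) (ℕ.<⇒≤ (after-shrinks G Left x∈)) ℕ.≤-refl))))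

s₂-step : ∀ G → s₂ G ≡ minimum (map (λ y → s₁ (G after y)) (R G))
s₂-step G = trans
  (s₂-stable ∣ G ∣ (suc ∣ G ∣) G ℕ.≤-refl (ℕ.n≤1+n _))
  (cong minimum (map-cong-local (tabulate λ {y} y∈ →
    s₁-stable ∣ G ∣ ∣ G after y ∣ (G after y) (ℕ.<⇒≤ (after-shrinks G Right y∈)) ℕ.≤-refl)))

-- A vertex of a rooted tree is named by the child indices on the path from the
-- root to it, the last one first; its level is the length of this list.
Address : Set
Address = List ℕ

infix 4 _◁_ _◁?_
data _◁_ : Address → Address → Set where
  child : ∀ {w} i → w ◁ i ∷ w

_◁?_ : Decidable _◁_
w ◁? []      = no λ ()
w ◁? (i ∷ v) = map′ (λ { refl → child i }) (λ { (child .i) → refl }) (≡-dec ℕ._≟_ w v)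

-- The vertices of level k when a vertex of level j has d j children.
level : (ℕ → ℕ) → ℕ → List Address
level d zero    = [] ∷ []
level d (suc k) = cartesianProductWith (λ w i → i ∷ w) (level d k) (upTo (d k))

private
  level-unique : ∀ d k → Unique (level d k)
  level-unique d zero    = All.[] ∷ []
  level-unique d (suc k) =
    Unique.cartesianProductWith⁺ _ (swap ∘ ∷-injective) (level-unique d k) (Unique.upTo⁺ (d k))

  level-length : ∀ d k {w} → w ∈ level d k → length w ≡ k
  level-length d zero    (here refl) = refl
  level-length d (suc k) w∈ with ∈-cartesianProductWith⁻ _ (level d k) (upTo (d k)) w∈
  ... | _ , _ , v∈ , _ , refl = cong suc (level-length d k v∈)

  level-disjoint : ∀ d {k l} → k ≢ l → Disjoint (level d k) (level d l)
  level-disjoint d k≢l (w∈k , w∈l) =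
    k≢l (trans (sym (level-length d _ w∈k)) (level-length d _ w∈l))

  levels-unique : ∀ d m → Unique (concatMap (level d) (upTo m))
  levels-unique d m = Unique.concat⁺
    (All.map⁺ (All.universal (level-unique d) (upTo m)))
    (AllPairs.map⁺ (AllPairs.map (level-disjoint d) (Unique.upTo⁺ m)))

arity : ℕ → ℕ → ℕ → ℕ
arity c n k = if k <ᵇ n then 3 else c

T : (c n : ℕ) → Position
T c n = record
  { Vertex   = Address
  ; _≟_      = ≡-dec ℕ._≟_
  ; vertices = concatMap (level (arity c n)) (upTo (2 + n))
  ; unique   = levels-unique (arity c n) (2 + n)
  ; _⟶_      = _◁_
  ; _⟶?_     = _◁?_
  ; owner    = λ w → if length w ≡ᵇ suc n then Right else Left
  }

infixl 6 _⊕_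
_⊕_ : Position → Position → Position
G ⊕ H = record
  { Vertex   = Vertex G ⊎ Vertex H
  ; _≟_      = Sum.≡-dec (G ._≟_) (H ._≟_)
  ; vertices = map inj₁ (vertices G) ++ map inj₂ (vertices H)
  ; unique   = Unique.++⁺ (Unique.map⁺ inj₁-injective (unique G)) (Unique.map⁺ inj₂-injective (unique H)) disjoint
  ; _⟶_      = Pointwise (G ._⟶_) (H ._⟶_)
  ; _⟶?_     = ⊎-decidable (G ._⟶?_) (H ._⟶?_)
  ; owner    = [ owner G , owner H ]′
  }
  where
  open Position
  disjoint : Disjoint (map inj₁ (vertices G)) (map inj₂ (vertices H))
  disjoint (p , q) with ∈-map⁻ inj₁ p | ∈-map⁻ inj₂ q
  ... | _ , _ , refl | _ , _ , ()

J : (c n : ℕ) → Position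
J c n = T c n ⊕ T c n

{-# OPTIONS --safe #-}

-- Left keeps the position a union of pairs of complete subtrees of equal height.
-- When Right takes the root-to-leaf path above a leaf in one tree of a pair,
-- Left takes the whole partner tree, and the siblings along the path, two at
-- each level, are the new pairs.  Hence Right gains only about c * 2 ^ n of the
-- roughly 2 * c * 3 ^ n vertices, and Left's score is bounded below by the
-- number of vertices minus Right's gain.
module Submission where

open import Defs
open import Data.Bool as Bool using (true; false; if_then_else_)
open import Data.Integer as ℤ using (+_; -[1+_])
import Data.Integer.Properties as ℤ
import Data.Integer.Tactic.RingSolver as ℤSolver
open import Data.List using (List; []; _∷_; _++_; length; map; filter; concatMap; cartesianProductWith; upTo)
import Data.List.Properties as List
open import Data.List.Extrema.Nat using (v≤min⁺; v≤max⁺)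
open import Data.List.Membership.Propositional using (_∈_; _∉_; lose; find)
open import Data.List.Membership.Propositional.Properties
open import Data.List.Relation.Binary.Subset.Propositional using (_⊆_)
open import Data.List.Relation.Binary.Permutation.Propositional using (_↭_)
import Data.List.Relation.Binary.Permutation.Propositional.Properties as Perm
open import Data.List.Relation.Unary.All as All using (All; []; _∷_)
import Data.List.Relation.Unary.All.Properties as All
open import Data.List.Relation.Unary.Any using (here; there)
open import Data.List.Relation.Unary.Unique.Propositional using (Unique; []; _∷_)
import Data.List.Relation.Unary.Unique.Propositional.Properties as Unique
open import Data.Nat as Nat using (ℕ; zero; suc; _+_; _*_; _∸_; _^_; NonZero; z≤n; s≤s) renaming (_≤_ to _≤ⁿ_; _<_ to _<ⁿ_)
open import Data.Nat.ListAction using (sum)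
open import Data.Nat.ListAction.Properties using (sum-++; sum-↭)
import Data.Nat.Properties as ℕ
import Data.Nat.Tactic.RingSolver as ℕSolver
open import Data.Product using (∃; ∃₂; _×_; _,_; proj₁; proj₂; -,_)
open import Data.Rational as ℚ using (ℚ; 0ℚ; 1ℚ; _/_; _-_; _<_; _≤_; _≥_; mkℚ; Positive; ↧ₙ_)
import Data.Rational.Properties as ℚ
open import Data.Rational.Unnormalised using (mkℚᵘ; *≤*)
import Data.Rational.Unnormalised.Properties as ℚᵘ
open import Data.Sum as Sum using (_⊎_; inj₁; inj₂; [_,_]′)
open import Data.Sum.Relation.Binary.Pointwise using (inj₁; inj₂)
open import Function using (_∘_; case_of_)
open import Relation.Binary.Construct.Closure.ReflexiveTransitive using (Star; ε; _◅_; _◅◅_; gmap)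
open import Relation.Binary.PropositionalEquality using (_≡_; _≢_; refl; sym; trans; cong; cong₂; subst; subst₂; module ≡-Reasoning)
open import Relation.Nullary using (yes; no; ¬_; ¬?; contradiction)

open Position

-- Three children per vertex let the strategy repeat: the path uses one child, and the other two
-- carry complete trees of equal height. A path entering a tree of height `suc k`, with `k`
-- positive, goes on in a tree of height `k` and opens one pair of height `k`. What Right can gain
-- thus doubles with each level, while the number of vertices triples. The leaves need care. When
-- Right takes a leaf, its sibling leaves lose their only parent and become forced, so he gets all
-- of them at once; this is the starting value `loss c 1`. Left, in contrast, forces nothing by
-- removing a whole tree. No subtree is ever rebuilt as a tree of its own. Every position is a
-- child-closed list of vertices of one fixed forest, and the pairs only name roots. The score is
-- controlled by a potential, the total `loss` of the current pairs.

Unique-⊆⇒length≤ : ∀ {A : Set} {xs ys : List A} → Unique xs → xs ⊆ ys → length xs ≤ⁿ length ys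
Unique-⊆⇒length≤ [] _ = z≤n
Unique-⊆⇒length≤ {xs = x ∷ xs} (x∉xs ∷ u) xs⊆ys with ∈-∃++ (xs⊆ys (here refl))
... | as , bs , refl = begin
  suc (length xs)          ≤⟨ s≤s (Unique-⊆⇒length≤ u xs⊆as++bs) ⟩
  suc (length (as ++ bs))  ≡⟨ Perm.↭-length (Perm.shift x as bs) ⟨
  length (as ++ x ∷ bs)    ∎
  where
  open ℕ.≤-Reasoning
  xs⊆as++bs : xs ⊆ as ++ bs
  xs⊆as++bs z∈xs with Perm.∈-resp-↭ (Perm.shift x as bs) (xs⊆ys (there z∈xs))
  ... | here refl = contradiction refl (All.lookup x∉xs z∈xs)
  ... | there z∈  = z∈

≤-minimum : ∀ {b x xs} → x ∈ xs → All (b ≤ⁿ_) xs → b ≤ⁿ minimum xs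
≤-minimum {xs = _ ∷ _} _ (p ∷ ps) = v≤min⁺ p ps

≤-maximum : ∀ {x xs} → x ∈ xs → x ≤ⁿ maximum xs
≤-maximum x∈xs = v≤max⁺ 0 _ (inj₂ (lose x∈xs ℕ.≤-refl))

∈-owned⁺ : ∀ G p {x} → x ∈ vertices G → owner G x ≡ p → x ∈ owned G p
∈-owned⁺ G p = ∈-filter⁺ (λ x → owner G x ≟ᴾ p)

∈-owned⁻ : ∀ G p {x} → x ∈ owned G p → x ∈ vertices G × owner G x ≡ p
∈-owned⁻ G p = ∈-filter⁻ (λ x → owner G x ≟ᴾ p)

∈-∖⁺ : ∀ G S {x} → x ∈ vertices G → x ∉ S → x ∈ vertices (G ∖ S)
∈-∖⁺ G S = ∈-filter⁺ (λ x → ¬? (_∈?_ G x S))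

∈-∖⁻ : ∀ G S {x} → x ∈ vertices (G ∖ S) → x ∈ vertices G × x ∉ S
∈-∖⁻ G S = ∈-filter⁻ (λ x → ¬? (_∈?_ G x S))

Taken-Left : ∀ G {u} → owner G u ≡ Left → Taken G u ≡ Succ G u
Taken-Left G {u} eq with owner G u
Taken-Left G refl | Left = refl

Taken-Right : ∀ G {u} → owner G u ≡ Right → Taken G u ≡ Pred G u
Taken-Right G {u} eq with owner G u
Taken-Right G refl | Right = refl

∈-Taken-Left⁺ : ∀ G {u v} → owner G u ≡ Left → v ∈ vertices G → Reach G u v → v ∈ Taken G u
∈-Taken-Left⁺ G {u} eq v∈G r = subst (_ ∈_) (sym (Taken-Left G eq)) (∈-filter⁺ (reach? G u) v∈G r)

∈-Taken-Left⁻ : ∀ G {u v} → owner G u ≡ Left → v ∈ Taken G u → Reach G u v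
∈-Taken-Left⁻ G {u} eq v∈ =
  proj₂ (∈-filter⁻ (reach? G u) {xs = vertices G} (subst (_ ∈_) (Taken-Left G eq) v∈))

∈-Taken-Right⁺ : ∀ G {u v} → owner G u ≡ Right → v ∈ vertices G → Reach G v u → v ∈ Taken G u
∈-Taken-Right⁺ G {u} eq v∈G r =
  subst (_ ∈_) (sym (Taken-Right G eq)) (∈-filter⁺ (λ y → reach? G y u) v∈G r)

∈-Taken-Right⁻ : ∀ G {u v} → owner G u ≡ Right → v ∈ Taken G u → Reach G v u
∈-Taken-Right⁻ G {u} eq v∈ =
  proj₂ (∈-filter⁻ (λ y → reach? G y u) {xs = vertices G} (subst (_ ∈_) (Taken-Right G eq) v∈))

Forced : (G : Position) → Vertex G → Set
Forced G u = All (λ v → owner G v ≡ owner G u) (Taken G u)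

∈-Forc⁺ : ∀ G {u} → u ∈ vertices G → Forced G u → u ∈ Forc G
∈-Forc⁺ G = ∈-filter⁺ (λ u → All.all? (λ v → owner G v ≟ᴾ owner G u) (Taken G u))

∈-Forc⁻ : ∀ G {u} → u ∈ Forc G → u ∈ vertices G × Forced G u
∈-Forc⁻ G = ∈-filter⁻ (λ u → All.all? (λ v → owner G v ≟ᴾ owner G u) (Taken G u))

-- Forests in terms of a height function

record IsForest (c : ℕ) (F : Position) : Set where
  field
    -- Height above the leaves rather than level below the root: a subtree keeps its heights when
    -- everything above it is deleted, and `loss` depends on nothing else.
    height        : Vertex F → ℕ
    arc-height    : ∀ {x y} → Arc F x y → height x ≡ suc (height y)
    leaf-owner    : ∀ {x} → x ∈ vertices F → height x ≡ 0 → owner F x ≡ Right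
    inner-owner   : ∀ {x k} → x ∈ vertices F → height x ≡ suc k → owner F x ≡ Left
    inner-child   : ∀ {x k} → x ∈ vertices F → height x ≡ suc k → ∃ (Arc F x)
    parent-unique : ∀ {x y z} → Arc F x z → Arc F y z → x ≡ y
    leaf-children : ∀ {x} → height x ≡ 1 →
      ∃ λ zs → length zs ≤ⁿ c × (∀ {z} → Arc F x z → z ∈ zs)
    siblings      : ∀ {x z k} → Arc F x z → height z ≡ suc k →
      ∃₂ λ s t → Arc F x s × Arc F x t × (∀ {w} → Arc F x w → w ≡ z ⊎ w ≡ s ⊎ w ≡ t)

last-arc : ∀ {A : Set} {R : A → A → Set} {x z} → Star R x z → x ≡ z ⊎ ∃ λ y → Star R x y × R y z
last-arc ε       = inj₁ refl
last-arc (a ◅ r) with last-arc r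
... | inj₁ refl        = inj₂ (-, ε , a)
... | inj₂ (y , q , b) = inj₂ (y , a ◅ q , b)

-- A bound for what Right gains from a pair of trees of the given height when he
-- starts: his first move takes a path with its c leaves, and leaves one pair of
-- trees of each smaller positive height.  (A tree of height 0 is never paired.)
loss : ℕ → ℕ → ℕ
loss c 0             = 0
loss c 1             = suc c
loss c (suc (suc k)) = suc (loss c (suc k) + loss c (suc k))

module Forest {c : ℕ} {F : Position} (forest : IsForest c F) where
  open IsForest forest

  -- The descendant order

  V : Set
  V = Vertex F

  _∈F : V → Set
  x ∈F = x ∈ vertices F

  infix 4 _≼_ _∈₂_
  _≼_ : V → V → Set
  _≼_ = Reach F

  ≼-height : ∀ {x y} → x ≼ y → x ≡ y ⊎ height y <ⁿ height x
  ≼-height ε = inj₁ refl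
  ≼-height (_◅_ {j = z} a r) with ≼-height r
  ... | inj₁ refl = inj₂ (ℕ.≤-reflexive (sym (arc-height a)))
  ... | inj₂ y<z  = inj₂ (ℕ.<-trans y<z (ℕ.≤-reflexive (sym (arc-height a))))

  ≼-height≤ : ∀ {x y} → x ≼ y → height y ≤ⁿ height x
  ≼-height≤ r = [ (λ eq → ℕ.≤-reflexive (cong height (sym eq))) , ℕ.<⇒≤ ]′ (≼-height r)

  ≼-antisym : ∀ {x y} → x ≼ y → y ≼ x → x ≡ y
  ≼-antisym r q with ≼-height r
  ... | inj₁ eq  = eq
  ... | inj₂ y<x = contradiction (≼-height≤ q) (ℕ.<⇒≱ y<x)

  -- Unique parents force two paths into `z` to share their ends. In the step, a path from `y` to
  -- the child `w` of `x` is trivial or ends with the arc from `x`, so that `y` already reaches `x`.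
  ≼-comparable : ∀ {x y z} → x ≼ z → y ≼ z → x ≼ y ⊎ y ≼ x
  ≼-comparable ε q = inj₂ q
  ≼-comparable (a ◅ r) q with ≼-comparable r q
  ... | inj₁ w≼y = inj₁ (a ◅ w≼y)
  ... | inj₂ y≼w with last-arc y≼w
  ...   | inj₁ refl = inj₁ (a ◅ ε)
  ...   | inj₂ (v , y≼v , b) with parent-unique a b
  ...     | refl = inj₂ y≼v

  ≼-parent : ∀ {x p y} → x ≼ y → Arc F p y → x ≢ y → x ≼ p
  ≼-parent r a x≢y with last-arc r
  ... | inj₁ eq = contradiction eq x≢y
  ... | inj₂ (u , x≼u , b) with parent-unique a b
  ...   | refl = x≼u

  -- The two children are comparable, being above the same `p`, and children of one vertex have
  -- equal heights.
  sibling-unique : ∀ {x y z p} → Arc F x y → Arc F x z → y ≼ p → z ≼ p → y ≡ z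
  sibling-unique {x} {y} {z} a b y≼p z≼p =
    [ go a b , sym ∘ go b a ]′ (≼-comparable y≼p z≼p)
    where
    go : ∀ {u v} → Arc F x u → Arc F x v → u ≼ v → u ≡ v
    go e f u≼v with ≼-height u≼v
    ... | inj₁ eq  = eq
    ... | inj₂ v<u = contradiction (ℕ.suc-injective (trans (sym (arc-height f)) (arc-height e))) (ℕ.<⇒≢ v<u)

  leaf-below : ∀ k {x} → x ∈F → height x ≡ k → ∃ λ z → x ≼ z × height z ≡ 0
  leaf-below zero    x∈ hx = -, ε , hx
  leaf-below (suc k) x∈ hx with inner-child x∈ hx
  ... | y , a@(_ , y∈ , _) with leaf-below k y∈ (ℕ.suc-injective (trans (sym (arc-height a)) hx))
  ...   | z , r , hz = z , a ◅ r , hz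

  -- Credit of pairs, and a path through one tree

  credit : List (V × V) → ℕ
  -- One `loss` for each pair, not for each tree: when Right enters one tree, Left takes the other.
  -- The first component suffices because the heights in a pair agree.
  credit ps = sum (map (loss c ∘ height ∘ proj₁) ps)

  credit-++ : ∀ ps qs → credit (ps ++ qs) ≡ credit ps + credit qs
  credit-++ ps qs = trans (cong sum (List.map-++ _ ps qs)) (sum-++ (map _ ps) (map _ qs))

  _∈₂_ : V → List (V × V) → Set
  r ∈₂ ps = ∃ λ t → (r , t) ∈ ps ⊎ (t , r) ∈ ps

  ∈₂-⊆ : ∀ {ps qs r} → ps ⊆ qs → r ∈₂ ps → r ∈₂ qs
  ∈₂-⊆ f (t , inj₁ m) = t , inj₁ (f m)
  ∈₂-⊆ f (t , inj₂ m) = t , inj₂ (f m)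

  Inner : V → Set
  Inner x = ∃ λ k → height x ≡ suc k

  -- Right's move at a child of `p` deletes the parent `b`, which turns `s` into a root.
  Hangs : V → V → Set
  Hangs p s = Inner s × ∃ λ b → Arc F b s × b ≼ p

  -- Right's move at a child of p inside the tree rooted at r: it deletes `path`
  -- and cuts off the pairs of siblings in `pending`.
  record Detour (r p : V) : Set where
    field
      path     : List V
      pending  : List (V × V)
      cost     : length path + credit pending ≤ⁿ loss c (height r)
      on-path  : ∀ {v} → r ≼ v → v ≼ p → v ∈ path
      end      : ∀ {v} → Arc F p v → v ∈ path
      hanging  : All (λ (s , t) → height s ≡ height t × Hangs p s × Hangs p t) pending
      off-path : ∀ {v} → r ≼ v → v ≼ p ⊎ Arc F p v ⊎ ∃ λ s → s ∈₂ pending × r ≼ s × s ≼ v × ¬ s ≼ p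

  -- This induction along the path is where the recurrence of `loss` comes from: 1 for `r`, one
  -- `loss` for the tree in which the path continues, and one for the pair of siblings cut off
  -- there. At the bottom, `p` and its at most `c` leaves give `suc c`.
  detour : ∀ {r p} → r ≼ p → height p ≡ 1 → Detour r p
  detour {p = p} ε hp = record
    { path     = p ∷ proj₁ leaves
    ; pending  = []
    ; cost     = bound
    ; on-path  = λ p≼v v≼p → here (≼-antisym v≼p p≼v)
    ; end      = λ a → there (proj₂ (proj₂ leaves) a)
    ; hanging  = []
    ; off-path = off
    }
    where
    leaves = leaf-children hp

    bound : suc (length (proj₁ leaves)) + 0 ≤ⁿ loss c (height p)
    bound = begin
      suc (length (proj₁ leaves)) + 0  ≡⟨ ℕ.+-identityʳ _ ⟩
      suc (length (proj₁ leaves))      ≤⟨ s≤s (proj₁ (proj₂ leaves)) ⟩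
      loss c 1                         ≡⟨ cong (loss c) hp ⟨
      loss c (height p)                ∎
      where open ℕ.≤-Reasoning

    off : ∀ {v} → p ≼ v → v ≼ p ⊎ Arc F p v ⊎ ∃ λ s → s ∈₂ [] × p ≼ s × s ≼ v × ¬ s ≼ p
    off ε           = inj₁ ε
    off (a ◅ ε)     = inj₂ (inj₁ a)
    off (a ◅ b ◅ _) with trans (sym hp) (trans (arc-height a) (cong suc (arc-height b)))
    ... | ()
  detour {r} {p} (_◅_ {j = q} a q≼p) hp = record
    { path     = r ∷ path
    ; pending  = (s , t) ∷ pending
    ; cost     = bound
    ; on-path  = on
    ; end      = there ∘ end
    ; hanging  = (trans hs (sym ht) , ((k , hs) , r , as , a ◅ q≼p) , ((k , ht) , r , at , a ◅ q≼p)) ∷ hanging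
    ; off-path = off
    }
    where
    open Detour (detour q≼p hp)

    -- `q` lies above `p`, of height 1, so `q` and its siblings are inner vertices, and no pair of
    -- leaves is ever created.
    positive : Inner q
    positive with height q | subst (_≤ⁿ height q) hp (≼-height≤ q≼p)
    ... | suc k | _ = k , refl

    k = proj₁ positive
    sib = siblings a (proj₂ positive)
    s = proj₁ sib
    t = proj₁ (proj₂ sib)
    as = proj₁ (proj₂ (proj₂ sib))
    at = proj₁ (proj₂ (proj₂ (proj₂ sib)))
    only = proj₂ (proj₂ (proj₂ (proj₂ sib)))

    same-height : ∀ {w} → Arc F r w → height w ≡ suc k
    same-height b = trans (ℕ.suc-injective (trans (sym (arc-height b)) (arc-height a))) (proj₂ positive)

    hs = same-height as
    ht = same-height at

    bound : suc (length path) + (loss c (height s) + credit pending) ≤ⁿ loss c (height r)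
    bound = begin
      suc (length path + (loss c (height s) + credit pending))
        ≡⟨ cong suc (trans (cong (λ m → length path + m) (ℕ.+-comm (loss c (height s)) _))
             (sym (ℕ.+-assoc (length path) _ _))) ⟩
      suc (length path + credit pending + loss c (height s))
        ≤⟨ s≤s (ℕ.+-monoˡ-≤ _ cost) ⟩
      suc (loss c (height q) + loss c (height s))
        ≡⟨ cong₂ (λ m n → suc (loss c m + loss c n)) (proj₂ positive) hs ⟩
      loss c (suc (suc k))
        ≡⟨ cong (loss c) (trans (arc-height a) (cong suc (proj₂ positive))) ⟨
      loss c (height r) ∎
      where open ℕ.≤-Reasoning

    on : ∀ {v} → r ≼ v → v ≼ p → v ∈ r ∷ path
    on ε       _   = here refl
    on (b ◅ w≼v) v≼p with sibling-unique a b q≼p (w≼v ◅◅ v≼p)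
    ... | refl = there (on-path w≼v v≼p)

    apart : ∀ {w} → Arc F r w → w ≢ q → ¬ w ≼ p
    apart b w≢q w≼p = w≢q (sibling-unique b a w≼p q≼p)

    off : ∀ {v} → r ≼ v → v ≼ p ⊎ Arc F p v ⊎ ∃ λ x → x ∈₂ (s , t) ∷ pending × r ≼ x × x ≼ v × ¬ x ≼ p
    off ε = inj₁ (a ◅ q≼p)
    off (_◅_ {j = w} b w≼v) with _≟_ F w q
    ... | no w≢q = inj₂ (inj₂ (w , member (only b) , b ◅ ε , w≼v , apart b w≢q))
      where
      member : w ≡ q ⊎ w ≡ s ⊎ w ≡ t → w ∈₂ (s , t) ∷ pending
      member (inj₁ eq)          = contradiction eq w≢q
      member (inj₂ (inj₁ refl)) = t , inj₁ (here refl)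
      member (inj₂ (inj₂ refl)) = s , inj₂ (here refl)
    ... | yes refl with off-path w≼v
    ...   | inj₁ v≼p       = inj₁ v≼p
    ...   | inj₂ (inj₁ e)  = inj₂ (inj₁ e)
    ...   | inj₂ (inj₂ (x , x∈ , q≼x , x≼v , n)) = inj₂ (inj₂ (x , ∈₂-⊆ there x∈ , a ◅ q≼x , x≼v , n))

  -- Positions as child-closed vertex lists

  on : (vs : List V) → Unique vs → Position
  -- Deletion changes only the vertex list, so `on vs u after x` is again of the form `on ws _` by
  -- definition, and the induction needs no transport between positions.
  on vs u = record
    { Vertex = V ; _≟_ = _≟_ F ; vertices = vs ; unique = u
    ; _⟶_ = _⟶_ F ; _⟶?_ = _⟶?_ F ; owner = owner F }

  record Closed (vs : List V) : Set where
    field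
      inside : vs ⊆ vertices F
      closed : ∀ {v w} → v ∈ vs → Arc F v w → w ∈ vs

    closed* : ∀ {v w} → v ∈ vs → v ≼ w → w ∈ vs
    closed* v∈ ε       = v∈
    closed* v∈ (a ◅ r) = closed* (closed v∈ a) r

    ≼⇒Reach : ∀ u {v w} → v ∈ vs → v ≼ w → Reach (on vs u) v w
    ≼⇒Reach u v∈ ε                     = ε
    ≼⇒Reach u v∈ (a@(_ , _ , v⟶w) ◅ r) = (v∈ , closed v∈ a , v⟶w) ◅ ≼⇒Reach u (closed v∈ a) r

    Reach⇒≼ : ∀ u {v w} → Reach (on vs u) v w → v ≼ w
    Reach⇒≼ u = gmap (λ v → v) (λ (v∈ , w∈ , a) → inside v∈ , inside w∈ , a)

    module _ (u : Unique vs) where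
      private G = on vs u

      -- An inner vertex of a closed position still has a leaf below it, owned by Right, so it is
      -- not forced. A leaf whose parent is present would take that parent, owned by Left.
      forced⁻ : ∀ {v} → v ∈ Forc G → height v ≡ 0 × (∀ {w} → Arc F w v → w ∉ vs)
      forced⁻ {v} v∈Forc with ∈-Forc⁻ G v∈Forc
      ... | v∈ , forced with height v in eq
      ...   | suc k = contradiction
              (trans (sym Left-owned) (trans (sym (All.lookup forced taken)) Right-owned)) λ ()
        where
        leaf = leaf-below (suc k) (inside v∈) eq
        z = proj₁ leaf
        v≼z = proj₁ (proj₂ leaf)
        Left-owned = inner-owner (inside v∈) eq
        Right-owned = leaf-owner (inside (closed* v∈ v≼z)) (proj₂ (proj₂ leaf))
        taken : z ∈ Taken G v
        taken = ∈-Taken-Left⁺ G Left-owned (closed* v∈ v≼z) (≼⇒Reach u v∈ v≼z)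
      ...   | zero = refl , λ {w} a w∈ → contradiction
              (trans (sym (inner-owner (inside w∈) (arc-height a)))
                (trans (All.lookup forced (taken a w∈)) Right-owned)) λ ()
        where
        Right-owned = leaf-owner (inside v∈) eq
        taken : ∀ {w} → Arc F w v → w ∈ vs → w ∈ Taken G v
        taken a w∈ = ∈-Taken-Right⁺ G Right-owned w∈ (≼⇒Reach u w∈ (a ◅ ε))

      forced⁺ : ∀ {v} → v ∈ vs → height v ≡ 0 → (∀ {w} → Arc F w v → w ∉ vs) → v ∈ Forc G
      forced⁺ {v} v∈ hv orphan = ∈-Forc⁺ G v∈ (All.tabulate λ w∈ →
        cong (owner F) (alone (∈-Taken-Right⁻ G (leaf-owner (inside v∈) hv) w∈)))
        where
        alone : ∀ {w} → Reach G w v → w ≡ v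
        alone r with last-arc r
        ... | inj₁ eq = eq
        ... | inj₂ (x , _ , (x∈ , _ , a)) = contradiction x∈ (orphan (inside x∈ , inside v∈ , a))

  open Closed

  Closed-⊆ : ∀ {vs ws} → Closed vs → ws ⊆ vs → (∀ {v w} → v ∈ ws → w ∈ vs → Arc F v w → w ∈ ws) → Closed ws
  Closed-⊆ cl ws⊆vs f = record
    { inside = inside cl ∘ ws⊆vs
    ; closed = λ v∈ a → f v∈ (closed cl (ws⊆vs v∈) a) a }

  -- In a closed position this is what it means to be relevant.
  Parented : List V → Set
  Parented vs = ∀ {v} → v ∈ vs → height v ≡ 0 → ∃ λ p → Arc F p v × p ∈ vs

  Root : List V → V → Set
  Root vs r = Inner r × (∀ {u} → Arc F u r → u ∉ vs)

  Root-⊆ : ∀ {vs ws r} → ws ⊆ vs → Root vs r → Root ws r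
  Root-⊆ ws⊆vs (pos , top) = pos , λ a u∈ → top a (ws⊆vs u∈)

  root-below : ∀ {vs r v} → Closed vs → Root vs r → v ∈ vs → v ≼ r → v ≡ r
  root-below cl (_ , top) v∈ v≼r with last-arc v≼r
  ... | inj₁ eq              = eq
  ... | inj₂ (u , v≼u , a) = contradiction (closed* cl v∈ v≼u) (top a)

  -- The effect of one move

  module LeftMove {vs} (u : Unique vs) (cl : Closed vs) (parented : Parented vs)
                  {r} (r∈ : r ∈ vs) (root : Root vs r) where
    private
      G = on vs u
      us = vertices (G ∖ Taken G r)
      ws = vertices (G after r)

      r-Left : owner F r ≡ Left
      r-Left = inner-owner (inside cl r∈) (proj₂ (proj₁ root))

      ∈us⁺ : ∀ {v} → v ∈ vs → ¬ r ≼ v → v ∈ us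
      ∈us⁺ v∈ n = ∈-∖⁺ G _ v∈ (n ∘ Reach⇒≼ cl u ∘ ∈-Taken-Left⁻ G r-Left)

      ∈us⁻ : ∀ {v} → v ∈ us → v ∈ vs × ¬ r ≼ v
      ∈us⁻ v∈us with ∈-∖⁻ G _ v∈us
      ... | v∈ , v∉ = v∈ , λ r≼v → v∉ (∈-Taken-Left⁺ G r-Left v∈ (≼⇒Reach cl u r∈ r≼v))

      -- If `r` reached the child `w`, it would be `w`, which the root condition excludes, or reach
      -- the parent `v`.
      survives : ∀ {v w} → v ∈ vs → ¬ r ≼ v → Arc F v w → ¬ r ≼ w
      survives {w = w} v∈ n a r≼w with _≟_ F r w
      ... | yes refl = proj₂ root a v∈
      ... | no r≢w   = n (≼-parent r≼w a r≢w)

      us-closed : Closed us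
      us-closed = Closed-⊆ cl (proj₁ ∘ ∈us⁻) λ v∈ w∈ a →
        let v∈vs , n = ∈us⁻ v∈ in ∈us⁺ w∈ (survives v∈vs n a)

    -- No vertex becomes forced. It would be a leaf that has just lost its parent `p`, but `r ≼ p`
    -- implies that `r` reaches the leaf as well.
    ∈-after⁺ : ∀ {v} → v ∈ vs → ¬ r ≼ v → v ∈ ws
    ∈-after⁺ {v} v∈ n = ∈-∖⁺ G _ v∈ λ v∈Rmv → [ taken , forc ]′ (∈-++⁻ (Taken G r) v∈Rmv)
      where
      taken : v ∉ Taken G r
      taken = n ∘ Reach⇒≼ cl u ∘ ∈-Taken-Left⁻ G r-Left
      forc : v ∉ Forc (G ∖ Taken G r)
      forc v∈Forc with forced⁻ us-closed _ v∈Forc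
      ... | hv , orphan with parented v∈ hv
      ...   | p , a , p∈ = orphan a (∈us⁺ p∈ λ r≼p → n (r≼p ◅◅ (a ◅ ε)))

    ∈-after⁻ : ∀ {v} → v ∈ ws → v ∈ vs × ¬ r ≼ v
    ∈-after⁻ v∈ws with ∈-∖⁻ G _ v∈ws
    ... | v∈ , v∉ = v∈ , λ r≼v → v∉ (∈-++⁺ˡ (∈-Taken-Left⁺ G r-Left v∈ (≼⇒Reach cl u r∈ r≼v)))

    after-closed : Closed ws
    after-closed = Closed-⊆ cl (proj₁ ∘ ∈-after⁻) λ v∈ w∈ a →
      let v∈vs , n = ∈-after⁻ v∈ in ∈-after⁺ w∈ (survives v∈vs n a)

  module RightMove {vs} (u : Unique vs) (cl : Closed vs) (parented : Parented vs)
                   {y p} (y∈ : y ∈ vs) (hy : height y ≡ 0) (p⟶y : Arc F p y) where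
    private
      G = on vs u
      us = vertices (G ∖ Taken G y)
      ws = vertices (G after y)

      y-Right : owner F y ≡ Right
      y-Right = leaf-owner (inside cl y∈) hy

      ∈us⁺ : ∀ {v} → v ∈ vs → ¬ v ≼ y → v ∈ us
      ∈us⁺ v∈ n = ∈-∖⁺ G _ v∈ (n ∘ Reach⇒≼ cl u ∘ ∈-Taken-Right⁻ G y-Right)

      ∈us⁻ : ∀ {v} → v ∈ us → v ∈ vs × ¬ v ≼ y
      ∈us⁻ v∈us with ∈-∖⁻ G _ v∈us
      ... | v∈ , v∉ = v∈ , λ v≼y → v∉ (∈-Taken-Right⁺ G y-Right v∈ (≼⇒Reach cl u v∈ v≼y))

      us-closed : Closed us
      us-closed = Closed-⊆ cl (proj₁ ∘ ∈us⁻) λ v∈ w∈ a →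
        ∈us⁺ w∈ λ w≼y → proj₂ (∈us⁻ v∈) (a ◅ w≼y)

    -- Only children of `p` can become forced. A leaf that loses its parent `q` has `q` above `y`;
    -- since `q` has height 1, just as `p` does, it equals `p`.
    ∈-after⁺ : ∀ {v} → v ∈ vs → ¬ v ≼ y → ¬ Arc F p v → v ∈ ws
    ∈-after⁺ {v} v∈ n m = ∈-∖⁺ G _ v∈ λ v∈Rmv → [ taken , forc ]′ (∈-++⁻ (Taken G y) v∈Rmv)
      where
      taken : v ∉ Taken G y
      taken = n ∘ Reach⇒≼ cl u ∘ ∈-Taken-Right⁻ G y-Right
      forc : v ∉ Forc (G ∖ Taken G y)
      forc v∈Forc with forced⁻ us-closed _ v∈Forc
      ... | hv , orphan with parented v∈ hv
      ...   | q , a , q∈ = orphan a (∈us⁺ q∈ q⋠y)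
        where
        q⋠y : ¬ q ≼ y
        q⋠y q≼y with last-arc q≼y
        ... | inj₁ refl with trans (sym hy) (arc-height a)
        ...   | ()
        q⋠y q≼y | inj₂ (p′ , q≼p′ , b) with parent-unique b p⟶y
        ...   | refl with ≼-height q≼p′
        ...     | inj₁ refl = m a
        ...     | inj₂ p<q = ℕ.<-irrefl
                    (trans (trans (arc-height p⟶y) (cong suc (trans hy (sym hv)))) (sym (arc-height a))) p<q

    -- The children of `p` are leaves, as `y` is, and they are orphaned when `p` goes; hence those
    -- not taken are forced and fall to Right.
    ∈-after⁻ : ∀ {v} → v ∈ ws → v ∈ vs × ¬ v ≼ y × ¬ Arc F p v
    ∈-after⁻ {v} v∈ws with ∈-∖⁻ G _ v∈ws
    ... | v∈ , v∉ = v∈ , v⋠y , λ a → v∉ (∈-++⁺ʳ (Taken G y)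
          (forced⁺ us-closed _ (∈us⁺ v∈ v⋠y) (leaf a) λ {w} b w∈us → orphan a b w∈us))
      where
      v⋠y : ¬ v ≼ y
      v⋠y v≼y = v∉ (∈-++⁺ˡ (∈-Taken-Right⁺ G y-Right v∈ (≼⇒Reach cl u v∈ v≼y)))
      leaf : Arc F p v → height v ≡ 0
      leaf a = trans (ℕ.suc-injective (trans (sym (arc-height a)) (arc-height p⟶y))) hy
      orphan : ∀ {w} → Arc F p v → Arc F w v → w ∉ us
      orphan a b w∈us with parent-unique a b
      ... | refl = proj₂ (∈us⁻ w∈us) (p⟶y ◅ ε)

    after-closed : Closed ws
    after-closed = Closed-⊆ cl (proj₁ ∘ ∈-after⁻) λ v∈ w∈ a →
      let _ , v⋠y , _ = ∈-after⁻ v∈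
      in ∈-after⁺ w∈ (λ w≼y → v⋠y (a ◅ w≼y)) λ p⟶w →
           case parent-unique a p⟶w of λ { refl → v⋠y (p⟶y ◅ ε) }

  -- The pairing invariant and Right's move

  Pairs : List V → List (V × V) → Set
  Pairs vs = All (λ (s , t) → height s ≡ height t × Root vs s × Root vs t)

  Pairs-⊆ : ∀ {vs ws ps} → ws ⊆ vs → Pairs vs ps → Pairs ws ps
  Pairs-⊆ ws⊆vs = All.map λ (eq , s , t) → eq , Root-⊆ ws⊆vs s , Root-⊆ ws⊆vs t

  pair-root : ∀ {vs ps r} → Pairs vs ps → r ∈₂ ps → Root vs r
  pair-root pairs (t , inj₁ m) = proj₁ (proj₂ (All.lookup pairs m))
  pair-root pairs (t , inj₂ m) = proj₂ (proj₂ (All.lookup pairs m))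

  -- `Q` varies because, between Right's move and Left's reply, there is one root outside the pairs:
  -- the partner of the tree just entered.
  Cover : List V → (V → Set) → Set
  Cover vs Q = ∀ {v} → v ∈ vs → ∃ λ q → Q q × q ∈ vs × q ≼ v

  -- Roots are inner, so a leaf lies strictly below its root, and closedness keeps the last vertex
  -- before it on the path.
  cover-parented : ∀ {vs Q} → Closed vs → (∀ {q} → Q q → Root vs q) → Cover vs Q → Parented vs
  cover-parented cl root cover {v} v∈ hv with cover v∈
  ... | q , Qq , q∈ , q≼v with last-arc q≼v
  ...   | inj₂ (p , q≼p , a) = p , a , closed* cl q∈ q≼p
  ...   | inj₁ refl with trans (sym hv) (proj₂ (proj₁ (root Qq)))
  ...     | ()

  pick : ∀ {vs ps r} → Pairs vs ps → r ∈₂ ps → ∃₂ λ t rest →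
    credit ps ≡ loss c (height r) + credit rest × Root vs t × Pairs vs rest ×
    (∀ {q} → q ∈₂ ps → q ≡ r ⊎ q ≡ t ⊎ q ∈₂ rest)
  pick {vs} {ps} {r} pairs (t , m) with extract m
    where
    extract : (r , t) ∈ ps ⊎ (t , r) ∈ ps → ∃₂ λ e rest → ps ↭ e ∷ rest × (e ≡ (r , t) ⊎ e ≡ (t , r))
    extract (inj₁ m) with as , bs , refl ← ∈-∃++ m = -, as ++ bs , Perm.shift _ as bs , inj₁ refl
    extract (inj₂ m) with as , bs , refl ← ∈-∃++ m = -, as ++ bs , Perm.shift _ as bs , inj₂ refl
  ... | e , rest , σ , which with Perm.All-resp-↭ σ pairs
  pick {r = r} pairs (t , m) | e , rest , σ , inj₁ refl | (eq , _ , root-t) ∷ pairs′ =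
    t , rest , sum-↭ (Perm.map⁺ _ σ) , root-t , pairs′ , split
    where
    split : ∀ {q} → q ∈₂ _ → q ≡ r ⊎ q ≡ t ⊎ q ∈₂ rest
    split (x , inj₁ n) with Perm.∈-resp-↭ σ n
    ... | here refl = inj₁ refl
    ... | there n′  = inj₂ (inj₂ (x , inj₁ n′))
    split (x , inj₂ n) with Perm.∈-resp-↭ σ n
    ... | here refl = inj₂ (inj₁ refl)
    ... | there n′  = inj₂ (inj₂ (x , inj₂ n′))
  -- Here `credit` reads the height of `t`; equality of heights in the pair turns it into that of
  -- `r`.
  pick {r = r} pairs (t , m) | e , rest , σ , inj₂ refl | (eq , root-t , _) ∷ pairs′ =
    t , rest , trans (sum-↭ (Perm.map⁺ _ σ)) (cong (λ h → loss c h + credit rest) eq) , root-t , pairs′ , split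
    where
    split : ∀ {q} → q ∈₂ _ → q ≡ r ⊎ q ≡ t ⊎ q ∈₂ rest
    split (x , inj₁ n) with Perm.∈-resp-↭ σ n
    ... | here refl = inj₂ (inj₁ refl)
    ... | there n′  = inj₂ (inj₂ (x , inj₁ n′))
    split (x , inj₂ n) with Perm.∈-resp-↭ σ n
    ... | here refl = inj₁ refl
    ... | there n′  = inj₂ (inj₂ (x , inj₂ n′))

  -- The trees of different pairs are not required to be disjoint, and a root may
  -- already be gone; it suffices that the remaining ones cover all of vs.
  record Paired (vs : List V) (ps : List (V × V)) : Set where
    field
      is-closed : Closed vs
      pairs     : Pairs vs ps
      cover     : Cover vs (_∈₂ ps)

  -- Dissolving the pair of `r` frees `loss c (height r)`, which by `cost` pays for the deleted path
  -- together with the credit of the new pairs. The partner `t` is left over for Left.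
  right-reduces : ∀ {vs ps} (u : Unique vs) → Paired vs ps → ∀ {y} → y ∈ R (on vs u) →
    let ws = vertices (on vs u after y) in
    ∃₂ λ t qs → length vs + credit qs ≤ⁿ length ws + credit ps × Closed ws × Root ws t × Pairs ws qs ×
      Cover ws (λ q → q ≡ t ⊎ q ∈₂ qs)
  right-reduces {vs} {ps} u P {y} y∈R with ∈-owned⁻ (on vs u) Right y∈R
  ... | y∈ , y-Right with Paired.cover P y∈
  ... | r , r∈₂ , r∈ , r≼y with last-arc r≼y
  ... | inj₁ refl = contradiction
          (trans (sym y-Right) (inner-owner (inside (Paired.is-closed P) y∈)
            (proj₂ (proj₁ (pair-root (Paired.pairs P) r∈₂))))) λ ()
  ... | inj₂ (p , r≼p , p⟶y) with pick (Paired.pairs P) r∈₂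
  ... | t , rest , credit-eq , t-root , rest-pairs , split =
        t , pending ++ rest , bound , after-closed , Root-⊆ ws⊆vs t-root ,
        All.++⁺ pending-pairs (Pairs-⊆ ws⊆vs rest-pairs) ,
        cover-after
    where
    open Paired P
    cl = is-closed
    parented = cover-parented cl (pair-root pairs) cover

    hy : height y ≡ 0
    hy with height y in eq
    ... | zero  = refl
    ... | suc _ = contradiction (trans (sym y-Right) (inner-owner (inside cl y∈) eq)) λ ()

    open RightMove u cl parented y∈ hy p⟶y
    open Detour (detour r≼p (trans (arc-height p⟶y) (cong suc hy)))
    ws = vertices (on vs u after y)

    ws⊆vs : ws ⊆ vs
    ws⊆vs = proj₁ ∘ ∈-after⁻

    hang : ∀ {s} → Hangs p s → Root ws s
    hang (pos , b , a , b≼p) = pos , λ a′ u∈ → case parent-unique a a′ of λ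
      { refl → proj₁ (proj₂ (∈-after⁻ u∈)) (b≼p ◅◅ (p⟶y ◅ ε)) }

    inner-not-leaf : ∀ {s} → Inner s → ¬ Arc F p s
    inner-not-leaf (k , hs) a = ℕ.0≢1+n (trans (sym hy)
      (trans (ℕ.suc-injective (trans (sym (arc-height p⟶y)) (arc-height a))) hs))

    inner-above : ∀ {s} → Inner s → s ≼ y → s ≼ p
    inner-above (k , hs) s≼y = ≼-parent s≼y p⟶y λ { refl → ℕ.0≢1+n (trans (sym hy) hs) }

    pending-pairs : Pairs ws pending
    pending-pairs = All.map (λ (eq , s , t) → eq , hang s , hang t) hanging

    -- No vertex of `vs` other than `r` lies above the root `r`, so what Right removes above `y`
    -- lies between `r` and `p`.
    accounted : ∀ {v} → v ∈ vs → v ∈ path ++ ws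
    accounted {v} v∈ with _∈?_ F v path
    ... | yes v∈path = ∈-++⁺ˡ v∈path
    ... | no v∉path  = ∈-++⁺ʳ path (∈-after⁺ v∈ v⋠y (v∉path ∘ end))
      where
      v⋠y : ¬ v ≼ y
      v⋠y v≼y with last-arc v≼y
      ... | inj₁ refl = v∉path (end p⟶y)
      ... | inj₂ (p′ , v≼p , a) with parent-unique a p⟶y
      ...   | refl with ≼-comparable r≼p v≼p
      ...     | inj₁ r≼v = v∉path (on-path r≼v v≼p)
      ...     | inj₂ v≼r with root-below cl (pair-root pairs r∈₂) v∈ v≼r
      ...       | refl = v∉path (on-path ε v≼p)

    bound : length vs + credit (pending ++ rest) ≤ⁿ length ws + credit ps
    bound = begin
      length vs + credit (pending ++ rest)
        ≤⟨ ℕ.+-monoˡ-≤ _ (Unique-⊆⇒length≤ u accounted) ⟩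
      length (path ++ ws) + credit (pending ++ rest)
        ≡⟨ cong₂ _+_ (trans (List.length-++ path) (ℕ.+-comm (length path) _)) (credit-++ pending rest) ⟩
      length ws + length path + (credit pending + credit rest)
        ≡⟨ trans (ℕ.+-assoc (length ws) _ _) (cong (λ m → length ws + m) (sym (ℕ.+-assoc (length path) _ _))) ⟩
      length ws + (length path + credit pending + credit rest)
        ≤⟨ ℕ.+-monoʳ-≤ (length ws) (ℕ.+-monoˡ-≤ _ cost) ⟩
      length ws + (loss c (height r) + credit rest)
        ≡⟨ cong (λ m → length ws + m) credit-eq ⟨
      length ws + credit ps ∎
      where open ℕ.≤-Reasoning

    cover-after : Cover ws (λ q → q ≡ t ⊎ q ∈₂ pending ++ rest)
    cover-after {v} v∈ws with ∈-after⁻ v∈ws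
    ... | v∈ , v⋠y , p↛v = go (cover v∈)
      where
      below-r : r ≼ v → ∃ λ q → (q ≡ t ⊎ q ∈₂ pending ++ rest) × q ∈ ws × q ≼ v
      below-r r≼v with off-path r≼v
      ... | inj₁ v≼p        = contradiction (v≼p ◅◅ (p⟶y ◅ ε)) v⋠y
      ... | inj₂ (inj₁ a)   = contradiction a p↛v
      ... | inj₂ (inj₂ (s , s∈ , r≼s , s≼v , s⋠p)) =
            s , inj₂ (∈₂-⊆ ∈-++⁺ˡ s∈) ,
            ∈-after⁺ (closed* cl r∈ r≼s) (s⋠p ∘ inner-above inner) (inner-not-leaf inner) , s≼v
        where
        inner = proj₁ (pair-root pending-pairs s∈)

      go : (∃ λ q → q ∈₂ ps × q ∈ vs × q ≼ v) → ∃ λ q → (q ≡ t ⊎ q ∈₂ pending ++ rest) × q ∈ ws × q ≼ v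
      go (q , q∈₂ , q∈ , q≼v) with _≟_ F q r
      ... | yes refl = below-r q≼v
      ... | no q≢r   = q , member (split q∈₂) , ∈-after⁺ q∈ q⋠y (inner-not-leaf (proj₁ (pair-root pairs q∈₂))) , q≼v
        where
        -- Otherwise `q` and `r` would both be above `y`, hence comparable, and comparable roots
        -- coincide.
        q⋠y : ¬ q ≼ y
        q⋠y q≼y with ≼-comparable r≼y q≼y
        ... | inj₁ r≼q = q≢r (sym (root-below cl (pair-root pairs q∈₂) r∈ r≼q))
        ... | inj₂ q≼r = q≢r (root-below cl (pair-root pairs r∈₂) q∈ q≼r)
        member : q ≡ r ⊎ q ≡ t ⊎ q ∈₂ rest → q ≡ t ⊎ q ∈₂ pending ++ rest
        member (inj₁ eq)        = contradiction eq q≢r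
        member (inj₂ (inj₁ eq)) = inj₁ eq
        member (inj₂ (inj₂ m))  = inj₂ (∈₂-⊆ (∈-++⁺ʳ pending) m)

  -- The bound on Left's score

  s₂-bound : ∀ n {vs ps} (u : Unique vs) → length vs ≤ⁿ n → Paired vs ps →
    length vs ≤ⁿ s₂ (on vs u) + credit ps
  -- Both bounds amortise with `credit` as potential: Right pays for the vertices he removes out of
  -- the credit, while Left scores all that he removes and leaves the credit unchanged. The number
  -- `n` makes the mutual recursion terminate.
  s₁-bound : ∀ n {vs ps r} (u : Unique vs) → length vs ≤ⁿ n → Closed vs → Pairs vs ps →
    Root vs r → r ∈ vs → Cover vs (λ q → q ≡ r ⊎ q ∈₂ ps) →
    length vs ≤ⁿ s₁ (on vs u) + credit ps

  s₂-bound zero    u vs≤0 _ = ℕ.≤-trans vs≤0 z≤n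
  s₂-bound (suc n) {[]} u _ _ = z≤n
  s₂-bound (suc n) {vs@(x ∷ xs)} {ps} u vs≤n P = begin
    -- A lower bound on a minimum must be one number for all moves, so the credit is first
    -- subtracted; truncation does no harm.
    length vs                                 ≤⟨ ℕ.m≤n+m∸n (length vs) (credit ps) ⟩
    credit ps + (length vs ∸ credit ps)       ≤⟨ ℕ.+-monoʳ-≤ (credit ps) every-move ⟩
    credit ps + s₂ G                          ≡⟨ ℕ.+-comm (credit ps) (s₂ G) ⟩
    s₂ G + credit ps                          ∎
    where
    open ℕ.≤-Reasoning
    open Paired P
    G = on vs u

    -- As `minimum []` is 0, a move of Right must be exhibited: any leaf below any vertex.
    some-move : ∃ (_∈ R G)
    some-move with leaf-below _ (inside is-closed (here refl)) refl
    ... | z , x≼z , hz = z , ∈-owned⁺ G Right z∈ (leaf-owner (inside is-closed z∈) hz)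
      where z∈ = closed* is-closed (here refl) x≼z

    after-move : ∀ {y} → y ∈ R G → length vs ∸ credit ps ≤ⁿ s₁ (G after y)
    after-move {y} y∈R with right-reduces u P y∈R
    ... | t , qs , vs≤ws , cl , t-root , qs-pairs , ws-cover =
      ℕ.m≤n+o⇒m∸n≤o _ (credit ps) (ℕ.+-cancelʳ-≤ (credit qs) _ _ (begin
        length vs + credit qs                       ≤⟨ vs≤ws ⟩
        length ws + credit ps                       ≤⟨ ℕ.+-monoˡ-≤ (credit ps) reply ⟩
        s₁ (G after y) + credit qs + credit ps      ≡⟨ ℕ.+-comm _ (credit ps) ⟩
        credit ps + (s₁ (G after y) + credit qs)    ≡⟨ ℕ.+-assoc (credit ps) _ _ ⟨
        credit ps + s₁ (G after y) + credit qs      ∎))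
      where
      ws = vertices (G after y)
      ws≤n : length ws ≤ⁿ n
      ws≤n = ℕ.≤-pred (ℕ.≤-trans (after-shrinks G Right y∈R) vs≤n)

      reply : length ws ≤ⁿ s₁ (G after y) + credit qs
      reply with _∈?_ F t ws
      ... | yes t∈ws = s₁-bound n (unique (G after y)) ws≤n cl qs-pairs t-root t∈ws ws-cover
      -- `Paired` does not guarantee that the partner is present. Taking any surviving root is then
      -- as good, since its pair may stay in `qs` and the credit does not grow.
      ... | no t∉ws  = any-root ws refl
        where
        without-t : ∀ {r} → Cover ws (λ q → q ≡ r ⊎ q ∈₂ qs)
        without-t v∈ with ws-cover v∈
        ... | q , inj₁ refl , q∈ , _ = contradiction q∈ t∉ws
        ... | q , inj₂ q∈₂ , q∈ , q≼v = q , inj₂ q∈₂ , q∈ , q≼v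

        any-root : ∀ us → us ≡ ws → length ws ≤ⁿ s₁ (G after y) + credit qs
        any-root []       eq = ℕ.≤-trans (ℕ.≤-reflexive (cong length (sym eq))) z≤n
        any-root (w ∷ us) eq with ws-cover (subst (w ∈_) eq (here refl))
        ... | q , inj₁ refl , q∈ , _ = contradiction q∈ t∉ws
        ... | q , inj₂ q∈₂  , q∈ , _ = 
              s₁-bound n (unique (G after y)) ws≤n cl qs-pairs (pair-root qs-pairs q∈₂) q∈ without-t

    every-move : length vs ∸ credit ps ≤ⁿ s₂ G
    every-move = begin
      length vs ∸ credit ps                            ≤⟨ ≤-minimum (∈-map⁺ _ (proj₂ some-move)) (All.map⁺ (All.tabulate after-move)) ⟩
      minimum (map (λ y → s₁ (G after y)) (R G))       ≡⟨ s₂-step G ⟨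
      s₂ G                                             ∎

  s₁-bound zero    {_ ∷ _} u () _ _ _ _ _
  s₁-bound (suc n) {vs} {ps} {r} u vs≤n cl pairs root r∈ cover = begin
    length vs                                     ≤⟨ Unique-⊆⇒length≤ u kept ⟩
    length (Rmv G r ++ ws)                        ≡⟨ List.length-++ (Rmv G r) ⟩
    length (Rmv G r) + length ws                  ≤⟨ ℕ.+-monoʳ-≤ (length (Rmv G r)) (s₂-bound n _ ws≤n paired) ⟩
    length (Rmv G r) + (s₂ (G after r) + credit ps) ≡⟨ ℕ.+-assoc (length (Rmv G r)) _ _ ⟨
    length (Rmv G r) + s₂ (G after r) + credit ps ≤⟨ ℕ.+-monoˡ-≤ (credit ps) played ⟩
    s₁ G + credit ps ∎
    where
    open ℕ.≤-Reasoning
    G = on vs u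
    ws = vertices (G after r)
    any-root : ∀ {q} → q ≡ r ⊎ q ∈₂ ps → Root vs q
    any-root (inj₁ refl) = root
    any-root (inj₂ q∈₂)  = pair-root pairs q∈₂
    open LeftMove u cl (cover-parented cl any-root cover) r∈ root

    r∈L : r ∈ L G
    r∈L = ∈-owned⁺ G Left r∈ (inner-owner (inside cl r∈) (proj₂ (proj₁ root)))

    ws≤n : length ws ≤ⁿ n
    ws≤n = ℕ.≤-pred (ℕ.≤-trans (after-shrinks G Left r∈L) vs≤n)

    played : length (Rmv G r) + s₂ (G after r) ≤ⁿ s₁ G
    played = ℕ.≤-trans (≤-maximum (∈-map⁺ (λ x → length (Rmv G x) + s₂ (G after x)) r∈L))
      (ℕ.≤-reflexive (sym (s₁-step G)))

    kept : vs ⊆ Rmv G r ++ ws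
    kept {v} v∈ with _∈?_ F v (Rmv G r)
    ... | yes v∈Rmv = ∈-++⁺ˡ v∈Rmv
    ... | no v∉Rmv  = ∈-++⁺ʳ (Rmv G r) (∈-∖⁺ G _ v∈ v∉Rmv)

    paired : Paired ws ps
    paired = record
      { is-closed = after-closed
      ; pairs     = Pairs-⊆ (proj₁ ∘ ∈-after⁻) pairs
      ; cover     = cover′
      }
      where
      cover′ : Cover ws (_∈₂ ps)
      cover′ v∈ws with ∈-after⁻ v∈ws
      ... | v∈ , r⋠v with cover v∈
      ...   | q , inj₁ refl , _ , q≼v = contradiction q≼v r⋠v
      ...   | q , inj₂ q∈₂ , q∈ , q≼v = q , q∈₂ , ∈-after⁺ q∈ (λ r≼q → r⋠v (r≼q ◅◅ q≼v)) , q≼v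

-- Disjoint unions

module _ (G H : Position) where
  ∈-⊕ˡ⁺ : ∀ {x} → x ∈ vertices G → inj₁ x ∈ vertices (G ⊕ H)
  ∈-⊕ˡ⁺ = ∈-++⁺ˡ ∘ ∈-map⁺ inj₁

  ∈-⊕ʳ⁺ : ∀ {y} → y ∈ vertices H → inj₂ y ∈ vertices (G ⊕ H)
  ∈-⊕ʳ⁺ = ∈-++⁺ʳ _ ∘ ∈-map⁺ inj₂

  ∈-⊕ˡ⁻ : ∀ {x} → inj₁ x ∈ vertices (G ⊕ H) → x ∈ vertices G
  ∈-⊕ˡ⁻ x∈ with ∈-++⁻ (map inj₁ (vertices G)) x∈
  ... | inj₁ m with _ , x∈G , refl ← ∈-map⁻ inj₁ m = x∈G
  ... | inj₂ m with _ , _ , () ← ∈-map⁻ inj₂ m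

  ∈-⊕ʳ⁻ : ∀ {y} → inj₂ y ∈ vertices (G ⊕ H) → y ∈ vertices H
  ∈-⊕ʳ⁻ y∈ with ∈-++⁻ (map inj₁ (vertices G)) y∈
  ... | inj₁ m with _ , _ , () ← ∈-map⁻ inj₁ m
  ... | inj₂ m with _ , y∈H , refl ← ∈-map⁻ inj₂ m = y∈H

  Arc-⊕ˡ⁺ : ∀ {x y} → Arc G x y → Arc (G ⊕ H) (inj₁ x) (inj₁ y)
  Arc-⊕ˡ⁺ (x∈ , y∈ , a) = ∈-⊕ˡ⁺ x∈ , ∈-⊕ˡ⁺ y∈ , inj₁ a

  Arc-⊕ʳ⁺ : ∀ {x y} → Arc H x y → Arc (G ⊕ H) (inj₂ x) (inj₂ y)
  Arc-⊕ʳ⁺ (x∈ , y∈ , a) = ∈-⊕ʳ⁺ x∈ , ∈-⊕ʳ⁺ y∈ , inj₂ a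

  Arc-⊕ˡ⁻ : ∀ {x w} → Arc (G ⊕ H) (inj₁ x) w → ∃ λ y → w ≡ inj₁ y × Arc G x y
  Arc-⊕ˡ⁻ (x∈ , y∈ , inj₁ a) = -, refl , ∈-⊕ˡ⁻ x∈ , ∈-⊕ˡ⁻ y∈ , a

  Arc-⊕ʳ⁻ : ∀ {x w} → Arc (G ⊕ H) (inj₂ x) w → ∃ λ y → w ≡ inj₂ y × Arc H x y
  Arc-⊕ʳ⁻ (x∈ , y∈ , inj₂ a) = -, refl , ∈-⊕ʳ⁻ x∈ , ∈-⊕ʳ⁻ y∈ , a

⊕-isForest : ∀ {c G H} → IsForest c G → IsForest c H → IsForest c (G ⊕ H)
⊕-isForest {c} {G} {H} P Q = record
  { height        = [ P.height , Q.height ]′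
  ; arc-height    = arc-height
  ; leaf-owner    = λ { {inj₁ x} x∈ → P.leaf-owner (∈-⊕ˡ⁻ G H x∈) ; {inj₂ y} y∈ → Q.leaf-owner (∈-⊕ʳ⁻ G H y∈) }
  ; inner-owner   = λ { {inj₁ x} x∈ → P.inner-owner (∈-⊕ˡ⁻ G H x∈) ; {inj₂ y} y∈ → Q.inner-owner (∈-⊕ʳ⁻ G H y∈) }
  ; inner-child   = inner-child
  ; parent-unique = parent-unique
  ; leaf-children = leaf-children
  ; siblings      = siblings
  }
  where
  module P = IsForest P
  module Q = IsForest Q

  arc-height : ∀ {x y} → Arc (G ⊕ H) x y → [ P.height , Q.height ]′ x ≡ suc ([ P.height , Q.height ]′ y)
  arc-height {inj₁ _} a with _ , refl , b ← Arc-⊕ˡ⁻ G H a = P.arc-height b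
  arc-height {inj₂ _} a with _ , refl , b ← Arc-⊕ʳ⁻ G H a = Q.arc-height b

  inner-child : ∀ {x k} → x ∈ vertices (G ⊕ H) → [ P.height , Q.height ]′ x ≡ suc k → ∃ (Arc (G ⊕ H) x)
  inner-child {inj₁ x} x∈ hx with P.inner-child (∈-⊕ˡ⁻ G H x∈) hx
  ... | y , a = inj₁ y , Arc-⊕ˡ⁺ G H a
  inner-child {inj₂ x} x∈ hx with Q.inner-child (∈-⊕ʳ⁻ G H x∈) hx
  ... | y , a = inj₂ y , Arc-⊕ʳ⁺ G H a

  parent-unique : ∀ {x y z} → Arc (G ⊕ H) x z → Arc (G ⊕ H) y z → x ≡ y
  parent-unique {inj₁ _} {inj₁ _} a b with _ , refl , a′ ← Arc-⊕ˡ⁻ G H a | _ , refl , b′ ← Arc-⊕ˡ⁻ G H b =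
    cong inj₁ (P.parent-unique a′ b′)
  parent-unique {inj₂ _} {inj₂ _} a b with _ , refl , a′ ← Arc-⊕ʳ⁻ G H a | _ , refl , b′ ← Arc-⊕ʳ⁻ G H b =
    cong inj₂ (Q.parent-unique a′ b′)
  parent-unique {inj₁ _} {inj₂ _} a b with _ , refl , _ ← Arc-⊕ˡ⁻ G H a | _ , () , _ ← Arc-⊕ʳ⁻ G H b
  parent-unique {inj₂ _} {inj₁ _} a b with _ , refl , _ ← Arc-⊕ʳ⁻ G H a | _ , () , _ ← Arc-⊕ˡ⁻ G H b

  leaf-children : ∀ {x} → [ P.height , Q.height ]′ x ≡ 1 →
    ∃ λ zs → length zs ≤ⁿ c × (∀ {z} → Arc (G ⊕ H) x z → z ∈ zs)
  leaf-children {inj₁ x} hx with zs , zs≤c , all ← P.leaf-children hx =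
    map inj₁ zs , subst (_≤ⁿ c) (sym (List.length-map inj₁ zs)) zs≤c ,
    λ a → let _ , eq , b = Arc-⊕ˡ⁻ G H a in subst (_∈ map inj₁ zs) (sym eq) (∈-map⁺ inj₁ (all b))
  leaf-children {inj₂ x} hx with zs , zs≤c , all ← Q.leaf-children hx =
    map inj₂ zs , subst (_≤ⁿ c) (sym (List.length-map inj₂ zs)) zs≤c ,
    λ a → let _ , eq , b = Arc-⊕ʳ⁻ G H a in subst (_∈ map inj₂ zs) (sym eq) (∈-map⁺ inj₂ (all b))

  siblings : ∀ {x z k} → Arc (G ⊕ H) x z → [ P.height , Q.height ]′ z ≡ suc k →
    ∃₂ λ s t → Arc (G ⊕ H) x s × Arc (G ⊕ H) x t × (∀ {w} → Arc (G ⊕ H) x w → w ≡ z ⊎ w ≡ s ⊎ w ≡ t)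
  siblings {inj₁ x} a hz with _ , refl , a′ ← Arc-⊕ˡ⁻ G H a with s , t , as , at , only ← P.siblings a′ hz =
    inj₁ s , inj₁ t , Arc-⊕ˡ⁺ G H as , Arc-⊕ˡ⁺ G H at ,
    λ b → case Arc-⊕ˡ⁻ G H b of λ { (_ , refl , b′) → Sum.map (cong inj₁) (Sum.map (cong inj₁) (cong inj₁)) (only b′) }
  siblings {inj₂ x} a hz with _ , refl , a′ ← Arc-⊕ʳ⁻ G H a with s , t , as , at , only ← Q.siblings a′ hz =
    inj₂ s , inj₂ t , Arc-⊕ʳ⁺ G H as , Arc-⊕ʳ⁺ G H at ,
    λ b → case Arc-⊕ʳ⁻ G H b of λ { (_ , refl , b′) → Sum.map (cong inj₂) (Sum.map (cong inj₂) (cong inj₂)) (only b′) }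

-- The trees `T c n` as forests

if-true : ∀ {A : Set} {b} {x y : A} → Bool.T b → (if b then x else y) ≡ x
if-true {b = true} _ = refl

if-false : ∀ {A : Set} {b} {x y : A} → ¬ Bool.T b → (if b then x else y) ≡ y
if-false {b = true}  n = contradiction _ n
if-false {b = false} _ = refl

arity-inner : ∀ {c n k} → k <ⁿ n → arity c n k ≡ 3
arity-inner = if-true ∘ ℕ.<⇒<ᵇ

arity-last : ∀ c n → arity c n n ≡ c
arity-last c n = if-false (ℕ.<-irrefl refl ∘ ℕ.<ᵇ⇒< n n)

∈-level⇒length : ∀ d k {w} → w ∈ level d k → length w ≡ k
∈-level⇒length d zero    (here refl) = refl
∈-level⇒length d (suc k) w∈ with ∈-cartesianProductWith⁻ _ (level d k) (upTo (d k)) w∈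
... | _ , _ , v∈ , _ , refl = cong suc (∈-level⇒length d k v∈)

module Tree (c n : ℕ) where
  private d = arity c n

  ∈-T⁺ : ∀ {k w} → k ≤ⁿ suc n → w ∈ level d k → w ∈ vertices (T c n)
  ∈-T⁺ k≤1+n w∈ = ∈-concatMap⁺ (level d) (lose (∈-upTo⁺ (s≤s k≤1+n)) w∈)

  ∈-T⁻ : ∀ {w} → w ∈ vertices (T c n) → length w ≤ⁿ suc n × w ∈ level d (length w)
  ∈-T⁻ w∈ with k , k∈ , w∈k ← find (∈-concatMap⁻ (level d) {xs = upTo (2 + n)} w∈)
    with refl ← ∈-level⇒length d k w∈k = ℕ.≤-pred (∈-upTo⁻ k∈) , w∈k

  T-child⁺ : ∀ {w i} → w ∈ vertices (T c n) → length w ≤ⁿ n → i <ⁿ d (length w) → Arc (T c n) w (i ∷ w)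
  T-child⁺ {w} w∈ w≤n i<d =
    w∈ , ∈-T⁺ (s≤s w≤n) (∈-cartesianProductWith⁺ _ (proj₂ (∈-T⁻ w∈)) (∈-upTo⁺ i<d)) , child _

  T-child⁻ : ∀ {w z} → Arc (T c n) w z → length w ≤ⁿ n × ∃ λ i → z ≡ i ∷ w × i <ⁿ d (length w)
  T-child⁻ (w∈ , z∈ , child {w} i) with ∈-T⁻ z∈
  ... | z≤ , z∈level with ∈-cartesianProductWith⁻ _ (level d (length w)) (upTo (d (length w))) z∈level
  ...   | _ , _ , _ , i∈ , refl = ℕ.≤-pred z≤ , i , refl , ∈-upTo⁻ i∈

  T-below-root : ∀ {w} → w ∈ vertices (T c n) → Reach (T c n) [] w
  T-below-root {[]}    _  = ε
  T-below-root {i ∷ w} z∈ with ∈-T⁻ z∈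
  ... | z≤ , z∈level with ∈-cartesianProductWith⁻ _ (level d (length w)) (upTo (d (length w))) z∈level
  ...   | _ , _ , w∈level , _ , refl = T-below-root w∈ ◅◅ ((w∈ , z∈ , child i) ◅ ε)
    where w∈ = ∈-T⁺ (ℕ.<⇒≤ z≤) w∈level

  T-isForest : 1 ≤ⁿ c → IsForest c (T c n)
  T-isForest 1≤c = record
    { height        = height
    ; arc-height    = arc-height
    ; leaf-owner    = λ {w} w∈ h → if-true (ℕ.≡⇒≡ᵇ (length w) (suc n)
                        (ℕ.≤-antisym (proj₁ (∈-T⁻ w∈)) (ℕ.m∸n≡0⇒m≤n h)))
    ; inner-owner   = λ {w} _ h → if-false (λ t → ℕ.<⇒≢ (inner {w} h) (ℕ.≡ᵇ⇒≡ (length w) (suc n) t))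
    ; inner-child   = λ {w} w∈ h → -, T-child⁺ w∈ (ℕ.≤-pred (inner {w} h)) (arity-positive _)
    ; parent-unique = λ { (_ , _ , child _) (_ , _ , child _) → refl }
    ; leaf-children = leaf-children
    ; siblings      = siblings
    }
    where
    height : Address → ℕ
    -- Subtraction truncates, so overlong addresses also get height 0; membership in the tree rules
    -- them out in `leaf-owner`.
    height w = suc n ∸ length w

    inner : ∀ {w k} → height w ≡ suc k → length w <ⁿ suc n
    inner {w} h = ℕ.m∸n≢0⇒n<m λ h0 → ℕ.0≢1+n (trans (sym h0) h)

    arity-positive : ∀ k → 0 <ⁿ d k
    arity-positive k with k Nat.<ᵇ n
    ... | true  = s≤s z≤n
    ... | false = 1≤c

    arc-height : ∀ {w z} → Arc (T c n) w z → height w ≡ suc (height z)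
    arc-height a with w≤n , _ , refl , _ ← T-child⁻ a = ℕ.+-∸-assoc 1 w≤n

    leaf-children : ∀ {w} → height w ≡ 1 →
      ∃ λ zs → length zs ≤ⁿ c × (∀ {z} → Arc (T c n) w z → z ∈ zs)
    leaf-children {w} h = map (_∷ w) (upTo c) ,
      ℕ.≤-reflexive (trans (List.length-map (_∷ w) (upTo c)) (List.length-upTo c)) , all
      where
      w≤n = ℕ.≤-pred (inner {w} h)
      last-level : length w ≡ n
      last-level = ℕ.≤-antisym w≤n (ℕ.m∸n≡0⇒m≤n (ℕ.suc-injective (trans (sym (ℕ.+-∸-assoc 1 w≤n)) h)))
      all : ∀ {z} → Arc (T c n) w z → z ∈ map (_∷ w) (upTo c)
      all a with _ , i , refl , i<d ← T-child⁻ a =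
        ∈-map⁺ (_∷ w) (∈-upTo⁺ (subst (i <ⁿ_) (trans (cong d last-level) (arity-last c n)) i<d))

    siblings : ∀ {w z k} → Arc (T c n) w z → height z ≡ suc k →
      ∃₂ λ s t → Arc (T c n) w s × Arc (T c n) w t × (∀ {v} → Arc (T c n) w v → v ≡ z ⊎ v ≡ s ⊎ v ≡ t)
    siblings {w} a@(w∈ , _) hz with w≤n , i , refl , i<d ← T-child⁻ a = others i (subst (i <ⁿ_) three i<d)
      where
      three : d (length w) ≡ 3
      three = arity-inner (ℕ.≤-pred (inner {i ∷ w} hz))

      kid : ∀ {j} → j <ⁿ 3 → Arc (T c n) w (j ∷ w)
      kid {j} j<3 = T-child⁺ w∈ w≤n (subst (j <ⁿ_) (sym three) j<3)

      other : ∀ {i j k} → (∀ {l} → l <ⁿ 3 → l ≡ i ⊎ l ≡ j ⊎ l ≡ k) →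
        ∀ {v} → Arc (T c n) w v → v ≡ i ∷ w ⊎ v ≡ j ∷ w ⊎ v ≡ k ∷ w
      other f b with _ , l , refl , l<d ← T-child⁻ b =
        Sum.map (cong (_∷ w)) (Sum.map (cong (_∷ w)) (cong (_∷ w))) (f (subst (l <ⁿ_) three l<d))

      others : ∀ i → i <ⁿ 3 → ∃₂ λ s t → Arc (T c n) w s × Arc (T c n) w t ×
        (∀ {v} → Arc (T c n) w v → v ≡ i ∷ w ⊎ v ≡ s ⊎ v ≡ t)
      others 0 _ = -, -, kid {1} (s≤s (s≤s z≤n)) , kid {2} (s≤s (s≤s (s≤s z≤n))) , other λ
        { {0} _ → inj₁ refl ; {1} _ → inj₂ (inj₁ refl) ; {2} _ → inj₂ (inj₂ refl) ; {suc (suc (suc _))} (s≤s (s≤s (s≤s ()))) }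
      others 1 _ = -, -, kid {0} (s≤s z≤n) , kid {2} (s≤s (s≤s (s≤s z≤n))) , other λ
        { {1} _ → inj₁ refl ; {0} _ → inj₂ (inj₁ refl) ; {2} _ → inj₂ (inj₂ refl) ; {suc (suc (suc _))} (s≤s (s≤s (s≤s ()))) }
      others 2 _ = -, -, kid {0} (s≤s z≤n) , kid {1} (s≤s (s≤s z≤n)) , other λ
        { {2} _ → inj₁ refl ; {0} _ → inj₂ (inj₁ refl) ; {1} _ → inj₂ (inj₂ refl) ; {suc (suc (suc _))} (s≤s (s≤s (s≤s ()))) }
      others (suc (suc (suc _))) (s≤s (s≤s (s≤s ())))

-- The two copies are the initial pair, with roots of height `suc n`; this is the reason for
-- doubling the tree when Right starts.
J-size≤ : ∀ c n → 1 ≤ⁿ c → ∣ J c n ∣ ≤ⁿ s₂ (J c n) + loss c (suc n)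
J-size≤ c n 1≤c = subst (λ l → ∣ J c n ∣ ≤ⁿ s₂ (J c n) + l) (ℕ.+-identityʳ _)
  (s₂-bound ∣ J c n ∣ (unique (J c n)) ℕ.≤-refl record
    { is-closed = record { inside = λ v∈ → v∈ ; closed = λ _ (_ , w∈ , _) → w∈ }
    ; pairs     = (refl , ((-, refl) , λ { (_ , _ , inj₁ ()) }) , ((-, refl) , λ { (_ , _ , inj₂ ()) })) ∷ []
    ; cover     = cover
    })
  where
  open Tree c n
  T-forest = T-isForest 1≤c
  open Forest (⊕-isForest T-forest T-forest)

  cover : Cover (vertices (J c n)) (_∈₂ (inj₁ [] , inj₂ []) ∷ [])
  cover {inj₁ w} w∈ = inj₁ [] , (-, inj₁ (here refl)) , ∈-⊕ˡ⁺ (T c n) (T c n) {[]} (here refl) ,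
    gmap inj₁ (Arc-⊕ˡ⁺ (T c n) (T c n)) (T-below-root (∈-⊕ˡ⁻ (T c n) (T c n) w∈))
  cover {inj₂ w} w∈ = inj₂ [] , (-, inj₂ (here refl)) , ∈-⊕ʳ⁺ (T c n) (T c n) {[]} (here refl) ,
    gmap inj₂ (Arc-⊕ʳ⁺ (T c n) (T c n)) (T-below-root (∈-⊕ʳ⁻ (T c n) (T c n) w∈))

-- Counting vertices

length-cartesianProductWith : ∀ {A B C : Set} (f : A → B → C) xs ys →
  length (cartesianProductWith f xs ys) ≡ length xs * length ys
length-cartesianProductWith f []       ys = refl
length-cartesianProductWith f (x ∷ xs) ys = trans (List.length-++ (map (f x) ys))
  (cong₂ _+_ (List.length-map (f x) ys) (length-cartesianProductWith f xs ys))

length-concatMap-upTo : ∀ {A : Set} (f : ℕ → List A) m →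
  length (concatMap f (upTo (suc m))) ≡ length (concatMap f (upTo m)) + length (f m)
length-concatMap-upTo f m = begin
  length (concatMap f (upTo (suc m)))         ≡⟨ cong (length ∘ concatMap f) (List.upTo-∷ʳ m) ⟨
  length (concatMap f (upTo m ++ m ∷ []))     ≡⟨ cong length (List.concatMap-++ f (upTo m) (m ∷ [])) ⟩
  length (concatMap f (upTo m) ++ f m ++ [])  ≡⟨ List.length-++ (concatMap f (upTo m)) ⟩
  length (concatMap f (upTo m)) + length (f m ++ [])
    ≡⟨ cong (λ xs → length (concatMap f (upTo m)) + length xs) (List.++-identityʳ (f m)) ⟩
  length (concatMap f (upTo m)) + length (f m) ∎
  where open ≡-Reasoning

length-level-suc : ∀ d k → length (level d (suc k)) ≡ length (level d k) * d k
length-level-suc d k = trans (length-cartesianProductWith _ (level d k) (upTo (d k)))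
  (cong (length (level d k) *_) (List.length-upTo (d k)))

length-inner-level : ∀ c n {k} → k ≤ⁿ n → length (level (arity c n) k) ≡ 3 ^ k
length-inner-level c n {zero}  _   = refl
length-inner-level c n {suc k} k<n = begin
  length (level (arity c n) (suc k))            ≡⟨ length-level-suc (arity c n) k ⟩
  length (level (arity c n) k) * arity c n k    ≡⟨ cong₂ _*_ (length-inner-level c n (ℕ.<⇒≤ k<n)) (arity-inner k<n) ⟩
  3 ^ k * 3                                     ≡⟨ ℕ.*-comm (3 ^ k) 3 ⟩
  3 ^ suc k                                     ∎
  where open ≡-Reasoning

-- The geometric sum is only about half of this, but the factor is absorbed by the choice of `c`,
-- and the induction merely needs doubling to stay below tripling.
length-inner-levels : ∀ c n {m} → m ≤ⁿ suc n → length (concatMap (level (arity c n)) (upTo m)) ≤ⁿ 3 ^ m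
length-inner-levels c n {zero}  _   = z≤n
length-inner-levels c n {suc m} m<n = begin
  length (concatMap (level (arity c n)) (upTo (suc m)))
    ≡⟨ length-concatMap-upTo (level (arity c n)) m ⟩
  length (concatMap (level (arity c n)) (upTo m)) + length (level (arity c n) m)
    ≤⟨ ℕ.+-mono-≤ (length-inner-levels c n (ℕ.<⇒≤ m<n)) (ℕ.≤-reflexive (length-inner-level c n (ℕ.≤-pred m<n))) ⟩
  3 ^ m + 3 ^ m
    ≤⟨ ℕ.+-monoʳ-≤ (3 ^ m) (ℕ.m≤m+n (3 ^ m) _) ⟩
  3 ^ suc m ∎
  where open ℕ.≤-Reasoning

3^n*c≤∣T∣ : ∀ c n → 3 ^ n * c ≤ⁿ ∣ T c n ∣
3^n*c≤∣T∣ c n = begin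
  3 ^ n * c                                    ≡⟨ cong₂ _*_ (length-inner-level c n ℕ.≤-refl) (arity-last c n) ⟨
  length (level d n) * d n                     ≡⟨ length-level-suc d n ⟨
  length (level d (suc n))                     ≤⟨ ℕ.m≤n+m _ _ ⟩
  length (concatMap (level d) (upTo (suc n))) + length (level d (suc n)) ≡⟨ length-concatMap-upTo (level d) (suc n) ⟨
  ∣ T c n ∣                                    ∎
  where
  open ℕ.≤-Reasoning
  d = arity c n

length-copies : ∀ {A : Set} (xs : List A) →
  length (map {B = A ⊎ A} inj₁ xs ++ map inj₂ xs) ≡ 2 * length xs
length-copies xs = trans (List.length-++ (map inj₁ xs))
  (cong₂ _+_ (List.length-map inj₁ xs) (trans (List.length-map inj₂ xs) (sym (ℕ.+-identityʳ _))))

2*3^n*c≤∣J∣ : ∀ c n → 2 * (3 ^ n * c) ≤ⁿ ∣ J c n ∣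
2*3^n*c≤∣J∣ c n = ℕ.≤-trans (ℕ.*-monoʳ-≤ 2 (3^n*c≤∣T∣ c n)) (ℕ.≤-reflexive (sym (length-copies (vertices (T c n)))))

∣L-J∣≤2*3^1+n : ∀ c n → length (L (J c n)) ≤ⁿ 2 * 3 ^ suc n
∣L-J∣≤2*3^1+n c n = begin
  length (L (J c n))                   ≤⟨ Unique-⊆⇒length≤ (Unique.filter⁺ (λ x → owner (J c n) x ≟ᴾ Left) (unique (J c n))) L⊆ ⟩
  length (map inj₁ inner ++ map inj₂ inner) ≡⟨ length-copies inner ⟩
  2 * length inner                     ≤⟨ ℕ.*-monoʳ-≤ 2 (length-inner-levels c n ℕ.≤-refl) ⟩
  2 * 3 ^ suc n                        ∎
  where
  open ℕ.≤-Reasoning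
  open Tree c n
  inner = concatMap (level (arity c n)) (upTo (suc n))

  ∈-inner : ∀ {w} → w ∈ vertices (T c n) → owner (T c n) w ≡ Left → w ∈ inner
  ∈-inner {w} w∈ Left-owned with ∈-T⁻ w∈
  ... | w≤ , w∈level = ∈-concatMap⁺ (level (arity c n)) (lose (∈-upTo⁺ (ℕ.≤∧≢⇒< w≤ not-last)) w∈level)
    where
    not-last : length w ≢ suc n
    not-last eq with trans (sym Left-owned) (if-true (ℕ.≡⇒≡ᵇ (length w) (suc n) eq))
    ... | ()

  L⊆ : L (J c n) ⊆ map inj₁ inner ++ map inj₂ inner
  L⊆ {inj₁ w} x∈ with ∈-owned⁻ (J c n) Left x∈
  ... | w∈ , o = ∈-++⁺ˡ (∈-map⁺ inj₁ (∈-inner (∈-⊕ˡ⁻ (T c n) (T c n) w∈) o))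
  L⊆ {inj₂ w} x∈ with ∈-owned⁻ (J c n) Left x∈
  ... | w∈ , o = ∈-++⁺ʳ (map inj₁ inner) (∈-map⁺ inj₂ (∈-inner (∈-⊕ʳ⁻ (T c n) (T c n) w∈) o))

-- Growth estimates

suc-loss : ∀ c k → suc (loss c (suc k)) ≡ (2 + c) * 2 ^ k
suc-loss c zero    = sym (ℕ.*-identityʳ (2 + c))
suc-loss c (suc k) = begin
  -- Adding 1 turns the recurrence `l` to `suc (l + l)` into plain doubling, starting from `2 + c`.
  suc (suc (l + l))      ≡⟨ cong suc (ℕ.+-suc l l) ⟨
  suc l + suc l          ≡⟨ cong (λ m → m + m) (suc-loss c k) ⟩
  x * 2 ^ k + x * 2 ^ k  ≡⟨ ℕ.*-distribˡ-+ x (2 ^ k) (2 ^ k) ⟨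
  x * (2 ^ k + 2 ^ k)    ≡⟨ cong (λ m → x * (2 ^ k + m)) (ℕ.+-identityʳ (2 ^ k)) ⟨
  x * 2 ^ suc k          ∎
  where
  open ≡-Reasoning
  l = loss c (suc k)
  x = 2 + c

-- An explicit form of the fact that 3 ^ n outgrows 2 ^ n; the factor `n` makes a threshold linear
-- in `q` sufficient. A constant `a` passes the induction step when 2 a + 2 is at most 3 a, and 2 is
-- the least such.
n*2^n≤2*3^n : ∀ n → n * 2 ^ n ≤ⁿ 2 * 3 ^ n
n*2^n≤2*3^n zero    = z≤n
n*2^n≤2*3^n (suc n) = begin
  suc n * (2 * 2 ^ n)              ≡⟨ expand n (2 ^ n) ⟩
  2 * (n * 2 ^ n) + 2 * 2 ^ n      ≤⟨ ℕ.+-mono-≤ (ℕ.*-monoʳ-≤ 2 (n*2^n≤2*3^n n)) (ℕ.*-monoʳ-≤ 2 (ℕ.^-monoˡ-≤ n (ℕ.n≤1+n 2))) ⟩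
  2 * (2 * 3 ^ n) + 2 * 3 ^ n      ≡⟨ collect (3 ^ n) ⟩
  2 * (3 * 3 ^ n)                  ∎
  where
  open ℕ.≤-Reasoning
  expand : ∀ n x → suc n * (2 * x) ≡ 2 * (n * x) + 2 * x
  expand = ℕSolver.solve-∀
  collect : ∀ y → 2 * (2 * y) + 2 * y ≡ 2 * (3 * y)
  collect = ℕSolver.solve-∀

-- The leaves alone, 2 * 3 ^ n * c of them, outweigh the inner vertices; the 3 is the quotient of 3
-- ^ suc n by 3 ^ n.
∣L-J∣*q≤∣J∣ : ∀ {c} n q → 3 * q ≤ⁿ c → length (L (J c n)) * q ≤ⁿ ∣ J c n ∣
∣L-J∣*q≤∣J∣ {c} n q 3q≤c = begin
  length (L (J c n)) * q     ≤⟨ ℕ.*-monoˡ-≤ q (∣L-J∣≤2*3^1+n c n) ⟩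
  2 * (3 * 3 ^ n) * q        ≡⟨ rearrange (3 ^ n) q ⟩
  2 * (3 ^ n * (3 * q))      ≤⟨ ℕ.*-monoʳ-≤ 2 (ℕ.*-monoʳ-≤ (3 ^ n) 3q≤c) ⟩
  2 * (3 ^ n * c)            ≤⟨ 2*3^n*c≤∣J∣ c n ⟩
  ∣ J c n ∣                  ∎
  where
  open ℕ.≤-Reasoning
  rearrange : ∀ x q → 2 * (3 * x) * q ≡ 2 * (x * (3 * q))
  rearrange = ℕSolver.solve-∀

loss*q≤∣J∣ : ∀ {c n} q → 1 ≤ⁿ c → 3 * q ≤ⁿ n → loss c (suc n) * q ≤ⁿ ∣ J c n ∣
loss*q≤∣J∣ {c} {n} q 1≤c 3q≤n = begin
  loss c (suc n) * q         ≤⟨ ℕ.*-monoˡ-≤ q (ℕ.n≤1+n (loss c (suc n))) ⟩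
  suc (loss c (suc n)) * q   ≡⟨ cong (_* q) (suc-loss c n) ⟩
  -- The 3 in the threshold for `n` arises here: `2 + c` is at most 3 c because `c` is positive.
  (2 + c) * 2 ^ n * q        ≤⟨ ℕ.*-monoˡ-≤ q (ℕ.*-monoˡ-≤ (2 ^ n) (ℕ.+-monoˡ-≤ c (ℕ.*-monoʳ-≤ 2 1≤c))) ⟩
  (2 * c + c) * 2 ^ n * q    ≡⟨ rearrange c (2 ^ n) q ⟩
  c * (3 * q * 2 ^ n)        ≤⟨ ℕ.*-monoʳ-≤ c (ℕ.*-monoˡ-≤ (2 ^ n) 3q≤n) ⟩
  c * (n * 2 ^ n)            ≤⟨ ℕ.*-monoʳ-≤ c (n*2^n≤2*3^n n) ⟩
  c * (2 * 3 ^ n)            ≡⟨ commute c (3 ^ n) ⟩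
  2 * (3 ^ n * c)            ≤⟨ 2*3^n*c≤∣J∣ c n ⟩
  ∣ J c n ∣                  ∎
  where
  open ℕ.≤-Reasoning
  rearrange : ∀ c x q → (2 * c + c) * x * q ≡ c * (3 * q * x)
  rearrange = ℕSolver.solve-∀
  commute : ∀ c y → c * (2 * y) ≡ 2 * (y * c)
  commute = ℕSolver.solve-∀

-- Passage to rationals

/-≤ : ∀ q m v .{{_ : Positive q}} .{{_ : NonZero v}} → m * ↧ₙ q ≤ⁿ v → + m / v ≤ q
-- A positive rational is at least 1 over its denominator, so only the denominator enters the
-- hypothesis. Unnormalised fractions avoid the gcd hidden in `_/_`.
/-≤ (mkℚ (+ suc p) d _) m v@(suc v-1) md≤v = ℚ.toℚᵘ-cancel-≤
  (ℚᵘ.≤-respˡ-≃ (ℚᵘ.≃-sym (ℚ.toℚᵘ-fromℚᵘ (mkℚᵘ (+ m) v-1)))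
  (*≤* (subst₂ ℤ._≤_ (ℤ.pos-* m (suc d)) (ℤ.pos-* (suc p) v) (ℤ.+≤+ (ℕ.≤-trans md≤v (ℕ.m≤m+n v _))))))

1-≤/ : ∀ q s l v .{{_ : Positive q}} .{{_ : NonZero v}} → v ≤ⁿ s + l → l * ↧ₙ q ≤ⁿ v → 1ℚ - q ≤ + s / v
1-≤/ q@(mkℚ (+ suc p) d _) s l v@(suc v-1) v≤s+l ld≤v = ℚ.toℚᵘ-cancel-≤
  (ℚᵘ.≤-respˡ-≃ (ℚᵘ.≃-sym (ℚ.toℚᵘ-homo-+ 1ℚ (ℚ.- q)))
  (ℚᵘ.≤-respʳ-≃ (ℚᵘ.≃-sym (ℚ.toℚᵘ-fromℚᵘ (mkℚᵘ (+ s) v-1))) (*≤* bound)))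
  where
  natural : v * suc d ≤ⁿ s * suc d + suc p * v
  natural = begin
    v * suc d                ≤⟨ ℕ.*-monoˡ-≤ (suc d) v≤s+l ⟩
    (s + l) * suc d          ≡⟨ ℕ.*-distribʳ-+ (suc d) s l ⟩
    s * suc d + l * suc d    ≤⟨ ℕ.+-monoʳ-≤ (s * suc d) (ℕ.≤-trans ld≤v (ℕ.m≤m+n v _)) ⟩
    s * suc d + suc p * v    ∎
    where open ℕ.≤-Reasoning

  -- The comparison by cross-multiplication, with the numerator of `1ℚ - q` as unnormalised addition
  -- computes it.
  bound : (+ 1 ℤ.* + suc d ℤ.+ -[1+ p ] ℤ.* + 1) ℤ.* + v ℤ.≤ + s ℤ.* + (1 * suc d)
  bound = begin
    (+ 1 ℤ.* D ℤ.+ (ℤ.- P) ℤ.* + 1) ℤ.* + v      ≡⟨ expand D P (+ v) ⟩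
    + v ℤ.* D ℤ.- P ℤ.* + v                      ≡⟨ cong₂ (λ x y → x ℤ.- y) (ℤ.pos-* v (suc d)) (ℤ.pos-* (suc p) v) ⟨
    + (v * suc d) ℤ.- + (suc p * v)              ≤⟨ ℤ.+-monoˡ-≤ (ℤ.- + (suc p * v)) (ℤ.+≤+ natural) ⟩
    + (s * suc d + suc p * v) ℤ.- + (suc p * v)  ≡⟨ cancel (+ (s * suc d)) (+ (suc p * v)) ⟩
    + (s * suc d)                                ≡⟨ ℤ.pos-* s (suc d) ⟩
    + s ℤ.* + suc d                              ≡⟨ cong (λ x → + s ℤ.* + x) (ℕ.*-identityˡ (suc d)) ⟨
    + s ℤ.* + (1 * suc d)                        ∎
    where
    open ℤ.≤-Reasoning
    D = + suc d
    P = + suc p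
    expand : ∀ D P v → (+ 1 ℤ.* D ℤ.+ (ℤ.- P) ℤ.* + 1) ℤ.* v ≡ v ℤ.* D ℤ.- P ℤ.* v
    expand = ℤSolver.solve-∀
    cancel : ∀ x y → x ℤ.+ y ℤ.- y ≡ x
    cancel = ℤSolver.solve-∀

theorem28 : (ε : ℚ) → 0ℚ < ε → ∃₂ λ (N C : ℕ) → (n c : ℕ) → 1 ≤ⁿ c → N ≤ⁿ n → C ≤ⁿ c →
    (+ length (L (J c n)) / ∣ J c n ∣ ≤ ε) × (+ s₂ (J c n) / ∣ J c n ∣ ≥ 1ℚ - ε)
-- Two separate uses of the same number: `n` is large against Right's gain, `c` against the number
-- of inner vertices.
theorem28 q 0<q = 3 * ↧ₙ q , 3 * ↧ₙ q , λ n c 1≤c N≤n C≤c →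
  /-≤ q (length (L (J c n))) (∣ J c n ∣) (∣L-J∣*q≤∣J∣ n (↧ₙ q) C≤c) ,
  1-≤/ q (s₂ (J c n)) (loss c (suc n)) (∣ J c n ∣) (J-size≤ c n 1≤c) (loss*q≤∣J∣ (↧ₙ q) 1≤c N≤n)
  where
  instance
    q-positive : Positive q
    q-positive = ℚ.positive 0<q
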